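{- Let $n$ be a positive integer, $k\ge 2$ an integer, and $\beta,\alpha_0,\alpha_1,\dots,\alpha_{n-1}$ non-negative integers with $0\le\beta\le k-1$. Then $$\det_{0\le i,j\le n-1}\bigl(C_{(k-1)\alpha_i+j+\beta,k}\bigr)=\prod_{0\le i<j\le n-1}(\alpha_j-\alpha_i)\prod_{i=0}^{n-1}\frac{((k-1)i+\beta+n)!\,(k\alpha_i+\beta)!}{(ki+\beta)!\,\alpha_i!\,((k-1)\alpha_i+\beta+n)!}.$$
   Context: For integers $k\ge2$ and $m\ge0$, the generalised Catalan number is $$C_{m,k}=\frac{m-(k-1)\lfloor\frac{m}{k-1}\rfloor+1}{m+\lfloor\frac{m}{k-1}\rfloor+1}\binom{m+\lfloor\frac{m}{k-1}\rfloor+1}{m+1}.$$ (Equivalently, $C_{m,k}$ is the number of lattice paths with unit steps $(1,0)$ and $(0,1)$ from $(0,0)$ to $(m,\lfloor m/(k-1)\rfloor)$ never passing above the line $x=(k-1)y$.) -}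

module Defs where

open import Data.Fin.Base using (Fin; zero; suc; toℕ; punchIn)
open import Data.Integer.Base as ℤ using (+_)
open import Data.Nat.Base as ℕ using (ℕ; zero; suc; _∸_; _!; NonZero; NonTrivial; 2+)
open import Data.Nat.Combinatorics using (_C_)
open import Data.Nat.Properties using (_!≢0; m*n≢0; _!*_!≢0)
open import Data.Rational.Base using (ℚ; _/_; _*_; -_; 1ℚ)
open import Data.Rational.Properties using (+-0-commutativeMonoid; *-1-commutativeMonoid; +-*-commutativeRing)
open import Algebra.Bundles using (CommutativeRing)
open import Algebra.Properties.Semiring.Exp (CommutativeRing.semiring +-*-commutativeRing) public using (_^_)
open import Algebra.Properties.CommutativeMonoid.Sum +-0-commutativeMonoid public using (sum)
open import Algebra.Properties.CommutativeMonoid.Sum *-1-commutativeMonoid public using () renaming (sum to product)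

-- Cofactor expansion along the first row.
det : ∀ {n} → (Fin n → Fin n → ℚ) → ℚ
det {zero}  A = 1ℚ
det {suc n} A = sum λ j →
  (- 1ℚ) ^ toℕ j * A zero j * det (λ r c → A (suc r) (punchIn j c))

pred-nonZero : ∀ k → .{{NonTrivial k}} → NonZero (k ∸ 1)
pred-nonZero (2+ _) = _

-- The number C_{m,k}; NonTrivial k says k ≥ 2.
genCatalan : (m k : ℕ) → .{{NonTrivial k}} → ℚ
genCatalan m k =
  ((+ m ℤ.- + ((k ∸ 1) ℕ.* q) ℤ.+ + 1) / suc (m ℕ.+ q))
    * (+ (suc (m ℕ.+ q) C suc m) / 1)
  where
  instance _ = pred-nonZero k
  q : ℕ
  q = m ℕ./ (k ∸ 1)

!*!*!≢0 : ∀ a b c → NonZero (a ! ℕ.* b ! ℕ.* c !)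
!*!*!≢0 a b c = m*n≢0 (a ! ℕ.* b !) (c !) {{a !* b !≢0}} {{c !≢0}}

factorialQuotient : (n k β i a : ℕ) → ℚ
factorialQuotient n k β i a =
  + (((k ∸ 1) ℕ.* i ℕ.+ β ℕ.+ n) ! ℕ.* (k ℕ.* a ℕ.+ β) !)
    / ((k ℕ.* i ℕ.+ β) ! ℕ.* a ! ℕ.* ((k ∸ 1) ℕ.* a ℕ.+ β ℕ.+ n) !)
  where
  instance _ = !*!*!≢0 (k ℕ.* i ℕ.+ β) a ((k ∸ 1) ℕ.* a ℕ.+ β ℕ.+ n)

{-# OPTIONS --safe #-}
module Submission where

-- Put K = k − 1, n = m + 1, A_i = β + i + 2, and let B_0 < B_1 < … be the integers greater
-- than β that are not divisible by k. Up to a factor depending only on a and a factor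
-- depending only on j, C_{Ka+j+β,k} equals
--   p_j(a) = ∏_{i<j} (k a + B_i) · ∏_{j≤i<m} (K a + A_i).
-- Consecutive p_j differ in a single linear form, so replacing each column by a combination of
-- itself and its left neighbour clears the first row and leaves a matrix of the same kind,
-- of size m, with A shifted. Iterating, det (p_j(α_i)) is the Vandermonde product times
-- ∏_{r+j<m} (k A_{r+j} − K B_j), and k A_{r+j} − K B_j = (r+1) k + 1 + ((β+j) mod K).
-- The product of these constants is evaluated by induction on n: the new factors are an
-- arithmetic progression of difference K with some multiples of k left out.


-- Products of natural numbers

module NaturalProducts where

  open import Data.Nat.Base
  open import Data.Nat.Properties
  open import Data.Nat.DivMod
  open import Data.Nat.Divisibility using (n∣m*n)
  open import Data.Nat.Tactic.RingSolver using (solve-∀)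
  open import Data.Product.Base using (_×_; _,_)
  open import Data.Sum.Base using (_⊎_; inj₁; inj₂)
  open import Function.Base using (_∘_)
  open import Relation.Binary.PropositionalEquality using (_≡_; refl; sym; trans; cong; cong₂; subst; module ≡-Reasoning)
  open import Relation.Nullary using (yes; no; contradiction)
  open ≡-Reasoning

  Π : (ℕ → ℕ) → ℕ → ℕ
  Π f zero    = 1
  Π f (suc n) = f 0 * Π (f ∘ suc) n

  Π-cong : ∀ {f g} n → (∀ i → f i ≡ g i) → Π f n ≡ Π g n
  Π-cong zero    f≗g = refl
  Π-cong (suc n) f≗g = cong₂ _*_ (f≗g 0) (Π-cong n (f≗g ∘ suc))

  Π-snoc : ∀ f n → Π f (suc n) ≡ Π f n * f n
  Π-snoc f zero    = *-comm (f 0) 1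
  Π-snoc f (suc n) = begin
    f 0 * Π (f ∘ suc) (suc n)          ≡⟨ cong (f 0 *_) (Π-snoc (f ∘ suc) n) ⟩
    f 0 * (Π (f ∘ suc) n * f (suc n))  ≡⟨ *-assoc (f 0) _ _ ⟨
    f 0 * Π (f ∘ suc) n * f (suc n)    ∎

  Π-+ : ∀ f m n → Π f (m + n) ≡ Π f m * Π (λ i → f (m + i)) n
  Π-+ f zero    n = sym (+-identityʳ _)
  Π-+ f (suc m) n = trans (cong (f 0 *_) (Π-+ (f ∘ suc) m n)) (sym (*-assoc (f 0) _ _))

  Π-* : ∀ f g n → Π (λ i → f i * g i) n ≡ Π f n * Π g n
  Π-* f g zero    = refl
  Π-* f g (suc n) = trans (cong (f 0 * g 0 *_) (Π-* (f ∘ suc) (g ∘ suc) n)) (interchange (f 0) (g 0) _ _)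
    where
    interchange : ∀ a b c d → a * b * (c * d) ≡ a * c * (b * d)
    interchange = solve-∀

  Π-const : ∀ a n → Π (λ _ → a) n ≡ a ^ n
  Π-const a zero    = refl
  Π-const a (suc n) = cong (a *_) (Π-const a n)

  Π-nonZero : ∀ f n → (∀ i → NonZero (f i)) → NonZero (Π f n)
  Π-nonZero f zero    nz = _
  Π-nonZero f (suc n) nz = m*n≢0 (f 0) _ {{nz 0}} {{Π-nonZero (f ∘ suc) n (nz ∘ suc)}}

  -- The product of h r j over all r + j < n.
  triangle : (ℕ → ℕ → ℕ) → ℕ → ℕ
  triangle h zero    = 1
  triangle h (suc n) = Π (h 0) (suc n) * triangle (h ∘ suc) n

  -- The product of h r j over all r + j + 1 = n.
  antidiagonal : (ℕ → ℕ → ℕ) → ℕ → ℕ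
  antidiagonal h zero    = 1
  antidiagonal h (suc n) = h 0 n * antidiagonal (h ∘ suc) n

  -- Each row gains one factor at its right end, and a new row of length one appears; the added
  -- factors are those with r + j = n. The recursion of `triangle` strips rows, while the evaluation
  -- below grows the triangle by antidiagonals.
  triangle-suc : ∀ h n → triangle h (suc n) ≡ triangle h n * antidiagonal h (suc n)
  triangle-suc h zero    = trans (*-identityʳ _) (sym (+-identityʳ _))
  triangle-suc h (suc n) = begin
    Π (h 0) (suc (suc n)) * triangle (h ∘ suc) (suc n)
      ≡⟨ cong₂ _*_ (Π-snoc (h 0) (suc n)) (triangle-suc (h ∘ suc) n) ⟩
    Π (h 0) (suc n) * h 0 (suc n) * (triangle (h ∘ suc) n * antidiagonal (h ∘ suc) (suc n))
      ≡⟨ arith (Π (h 0) (suc n)) (h 0 (suc n)) (triangle (h ∘ suc) n) (antidiagonal (h ∘ suc) (suc n)) ⟩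
    triangle h (suc n) * antidiagonal h (suc (suc n)) ∎
    where
    arith : ∀ a b c d → a * b * (c * d) ≡ a * c * (b * d)
    arith = solve-∀

  -- Division with remainder

  [r+q*n]%n≡r : ∀ {r n} q .{{_ : NonZero n}} → r < n → (r + q * n) % n ≡ r
  [r+q*n]%n≡r {r} {n} q r<n = trans ([m+kn]%n≡m%n r q n) (m<n⇒m%n≡m r<n)

  [r+q*n]/n≡q : ∀ {r n} q .{{_ : NonZero n}} → r < n → (r + q * n) / n ≡ q
  [r+q*n]/n≡q {r} {n} q r<n = begin
    (r + q * n) / n    ≡⟨ +-distrib-/-∣ʳ r (n∣m*n q) ⟩
    r / n + q * n / n  ≡⟨ cong₂ _+_ (m<n⇒m/n≡0 r<n) (m*n/n≡m q n) ⟩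
    q                  ∎

  suc-/ : ∀ m n .{{_ : NonZero n}} →
    suc m / n ≡ m / n ⊎ (suc m ≡ suc (m / n) * n × suc m / n ≡ suc (m / n))
  suc-/ m n with suc (m % n) ≟ n
  ... | yes eq = inj₂ (sm , trans (/-congˡ sm) (m*n/n≡m (suc (m / n)) n))
    where
    sm : suc m ≡ suc (m / n) * n
    sm = trans (cong suc (m≡m%n+[m/n]*n m n)) (cong (_+ m / n * n) eq)
  ... | no neq = inj₁ (begin
    suc m / n                        ≡⟨ /-congˡ (cong suc (m≡m%n+[m/n]*n m n)) ⟩
    (suc (m % n) + m / n * n) / n    ≡⟨ [r+q*n]/n≡q (m / n) (≤∧≢⇒< (m%n<n m n) neq) ⟩
    m / n                            ∎)

  -- Arithmetic progressions and multiples of k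

  module _ (K′ : ℕ) where

    private
      K = suc K′
      k = suc K

    -- Along h 0 n, h 1 (n ∸ 1), … each factor exceeds the previous one by K or, where the
    -- residue jumps from 0 to K ∸ 1, by 2K; the E values jumped over are multiples of k, and
    -- inserting them gives a full arithmetic progression.
    antidiagonal-completed : ∀ {β} → β ≤ K → ∀ (h : ℕ → ℕ → ℕ) n r s E → s < K → β + n ≡ s + E * K →
      (∀ i j → h i j ≡ (r + i) * k + suc ((β + j) % K)) →
      antidiagonal h (suc n) * Π (λ q → k * (r + s + suc (q * K))) E
        ≡ Π (λ d → r * k + suc s + d * K) (suc (n + E))
    antidiagonal-completed {β} β≤K h zero r s zero s<K eq h≡ = trans (*-identityʳ (h 0 0 * 1)) (cong (_* 1) (begin
      h 0 0                                ≡⟨ h≡ 0 0 ⟩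
      (r + 0) * k + suc ((β + 0) % K)      ≡⟨ cong₂ (λ x y → x * k + suc y) (+-identityʳ r)
                                                  (trans (%-congˡ eq) ([r+q*n]%n≡r 0 s<K)) ⟩
      r * k + suc s                        ≡⟨ +-identityʳ (r * k + suc s) ⟨
      r * k + suc s + 0                    ∎))
    -- Here `β` equals `K`: one multiple of `k` remains to be inserted, after the last factor.
    antidiagonal-completed {β} β≤K h zero r zero (suc zero) s<K eq h≡ = begin
      h 0 0 * 1 * (k * (r + 0 + 1) * 1)
        ≡⟨ cong (λ z → z * 1 * (k * (r + 0 + 1) * 1)) (trans (h≡ 0 0)
             (cong (λ y → (r + 0) * k + suc y) (trans (%-congˡ eq) ([r+q*n]%n≡r 1 s<K)))) ⟩
      ((r + 0) * k + 1) * 1 * (k * (r + 0 + 1) * 1)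
        ≡⟨ arith r K ⟩
      (r * k + 1 + 0) * ((r * k + 1 + 1 * K) * 1) ∎
      where
      arith : ∀ r K → ((r + 0) * suc K + 1) * 1 * (suc K * (r + 0 + 1) * 1) ≡ (r * suc K + 1 + 0) * ((r * suc K + 1 + 1 * K) * 1)
      arith = solve-∀
    -- With n = 0, this case and the next would make `β` larger than `K`.
    antidiagonal-completed {β} β≤K h zero r zero (suc (suc E)) s<K eq h≡ =
      contradiction (subst (_≤ K) (trans (sym (+-identityʳ β)) eq) β≤K) (m+1+n≰m K)
    antidiagonal-completed {β} β≤K h zero r (suc s) (suc E) s<K eq h≡ =
      contradiction (subst (_≤ K) (trans (sym (+-identityʳ β)) (trans eq (arith s K (E * K)))) β≤K) (m+1+n≰m K)
      where
      arith : ∀ s K x → suc s + (K + x) ≡ K + suc (s + x)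
      arith = solve-∀
    antidiagonal-completed {β} β≤K h (suc n) r zero zero s<K eq h≡ =
      contradiction (trans (sym (+-suc β n)) eq) λ ()
    -- The residue jumps from 0 to `K′`: the first inserted value k (r + 1) is the second term of
    -- the progression, so two terms are split off and the quotient falls to `E`.
    antidiagonal-completed {β} β≤K h (suc n) r zero (suc E) s<K eq h≡ = begin
      h 0 (suc n) * antidiagonal (h ∘ suc) (suc n) * (k * (r + 0 + 1) * Π (λ q → k * (r + 0 + suc (suc q * K))) E)
        ≡⟨ cong₂ (λ x y → x * antidiagonal (h ∘ suc) (suc n) * (k * (r + 0 + 1) * y))
             (trans (h≡ 0 (suc n)) (cong (λ y → (r + 0) * k + suc y) (trans (%-congˡ eq) ([r+q*n]%n≡r (suc E) s<K))))
             (Π-cong E λ q → cong (k *_) (arith₁ r K′ q)) ⟩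
      ((r + 0) * k + 1) * antidiagonal (h ∘ suc) (suc n) * (k * (r + 0 + 1) * Π (λ q → k * (suc r + K′ + suc (q * K))) E)
        ≡⟨ arith₂ r K (antidiagonal (h ∘ suc) (suc n)) _ ⟩
      (r * k + 1 + 0) * ((r * k + 1 + 1 * K) * (antidiagonal (h ∘ suc) (suc n) * Π (λ q → k * (suc r + K′ + suc (q * K))) E))
        ≡⟨ cong (λ z → (r * k + 1 + 0) * ((r * k + 1 + 1 * K) * z))
             (antidiagonal-completed β≤K (h ∘ suc) n (suc r) K′ E ≤-refl
               (suc-injective (trans (sym (+-suc β n)) eq))
               (λ i j → trans (h≡ (suc i) j) (cong (λ z → z * k + suc ((β + j) % K)) (+-suc r i)))) ⟩
      (r * k + 1 + 0) * ((r * k + 1 + 1 * K) * Π (λ d → suc r * k + suc K′ + d * K) (suc (n + E)))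
        ≡⟨ cong (λ z → (r * k + 1 + 0) * ((r * k + 1 + 1 * K) * z)) (Π-cong (suc (n + E)) λ d → arith₃ r K d) ⟩
      Π (λ d → r * k + 1 + d * K) (suc (suc (suc (n + E))))
        ≡⟨ cong (λ z → Π (λ d → r * k + 1 + d * K) (suc (suc z))) (+-suc n E) ⟨
      Π (λ d → r * k + 1 + d * K) (suc (suc (n + suc E))) ∎
      where
      arith₁ : ∀ r K′ q → r + 0 + suc (suc q * suc K′) ≡ suc r + K′ + suc (q * suc K′)
      arith₁ = solve-∀
      arith₂ : ∀ r K x y → ((r + 0) * suc K + 1) * x * (suc K * (r + 0 + 1) * y)
        ≡ (r * suc K + 1 + 0) * ((r * suc K + 1 + 1 * K) * (x * y))
      arith₂ = solve-∀
      arith₃ : ∀ r K d → suc r * suc K + K + d * K ≡ r * suc K + 1 + suc (suc d) * K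
      arith₃ = solve-∀
    -- The residue falls by one while the row rises by one, a net increase of k - 1 = K; nothing is
    -- inserted.
    antidiagonal-completed {β} β≤K h (suc n) r (suc s) E s<K eq h≡ = begin
      h 0 (suc n) * antidiagonal (h ∘ suc) (suc n) * Π (λ q → k * (r + suc s + suc (q * K))) E
        ≡⟨ cong₂ (λ x y → x * antidiagonal (h ∘ suc) (suc n) * y)
             (trans (h≡ 0 (suc n)) (cong (λ y → (r + 0) * k + suc y) (trans (%-congˡ eq) ([r+q*n]%n≡r E s<K))))
             (Π-cong E λ q → cong (λ z → k * (z + suc (q * K))) (+-suc r s)) ⟩
      ((r + 0) * k + suc (suc s)) * antidiagonal (h ∘ suc) (suc n) * Π (λ q → k * (suc r + s + suc (q * K))) E
        ≡⟨ arith₁ r k s (antidiagonal (h ∘ suc) (suc n)) _ ⟩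
      (r * k + suc (suc s) + 0) * (antidiagonal (h ∘ suc) (suc n) * Π (λ q → k * (suc r + s + suc (q * K))) E)
        ≡⟨ cong ((r * k + suc (suc s) + 0) *_)
             (antidiagonal-completed β≤K (h ∘ suc) n (suc r) s E (<-trans (n<1+n s) s<K)
               (suc-injective (trans (sym (+-suc β n)) eq))
               (λ i j → trans (h≡ (suc i) j) (cong (λ z → z * k + suc ((β + j) % K)) (+-suc r i)))) ⟩
      (r * k + suc (suc s) + 0) * Π (λ d → suc r * k + suc s + d * K) (suc (n + E))
        ≡⟨ cong ((r * k + suc (suc s) + 0) *_) (Π-cong (suc (n + E)) λ d → arith₂ r K s d) ⟩
      Π (λ d → r * k + suc (suc s) + d * K) (suc (suc (n + E))) ∎
      where
      arith₁ : ∀ r k s x y → ((r + 0) * k + suc (suc s)) * x * y ≡ (r * k + suc (suc s) + 0) * (x * y)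
      arith₁ = solve-∀
      arith₂ : ∀ r K s d → suc r * suc K + suc s + d * K ≡ r * suc K + suc (suc s) + suc d * K
      arith₂ = solve-∀

    -- Row r + 1 consists of the constants k A_{r+j} - K B_j. Row 0 is prepended because its entries
    -- occur as numerators of the Catalan numbers, and the enlarged triangle has a closed product.
    residueFactor : ℕ → ℕ → ℕ → ℕ
    residueFactor β r j = r * k + suc ((β + j) % K)

    -- For β ≤ K, the (i + 1)-st integer greater than β that is not divisible by k.
    skipping : ℕ → ℕ → ℕ
    skipping β i = suc (β + i + (β + i) / K)

    module _ {β : ℕ} (β≤K : β ≤ K) where

      -- In `antidiagonal-completed` with r = 0, the inserted multiples divided by `k` are exactly
      -- the first `E` terms of the progression. Cancelling them leaves the power of `k` on one side
      -- and the last n + 1 terms on the other.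
      antidiagonal-residueFactor : ∀ n →
        k ^ ((β + n) / K) * antidiagonal (residueFactor β) (suc n) ≡ Π (λ i → suc (K * i + β + n)) (suc n)
      antidiagonal-residueFactor n = *-cancelʳ-≡ _ _ P {{P≢0}} (begin
        k ^ E * X * P                              ≡⟨ arith₁ (k ^ E) X P ⟩
        X * (k ^ E * P)                            ≡⟨ cong (λ z → X * (z * P)) (Π-const k E) ⟨
        X * (Π (λ _ → k) E * P)                    ≡⟨ cong (X *_) (Π-* (λ _ → k) (λ q → s + suc (q * K)) E) ⟨
        X * Π (λ q → k * (s + suc (q * K))) E      ≡⟨ antidiagonal-completed β≤K (residueFactor β) n 0 s E
                                                        (m%n<n (β + n) K) M≡ (λ _ _ → refl) ⟩
        Π (λ d → suc s + d * K) (suc (n + E))      ≡⟨ cong (Π (λ d → suc s + d * K))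
                                                        (trans (cong suc (+-comm n E)) (sym (+-suc E n))) ⟩
        Π (λ d → suc s + d * K) (E + suc n)        ≡⟨ Π-+ (λ d → suc s + d * K) E (suc n) ⟩
        Π (λ d → suc s + d * K) E * Π (λ i → suc s + (E + i) * K) (suc n)
          ≡⟨ cong₂ _*_ (Π-cong E λ q → sym (+-suc s (q * K))) (Π-cong (suc n) shift) ⟩
        P * Π (λ i → suc (K * i + β + n)) (suc n)  ≡⟨ *-comm P _ ⟩
        Π (λ i → suc (K * i + β + n)) (suc n) * P  ∎)
        where
        E = (β + n) / K
        s = (β + n) % K
        X = antidiagonal (residueFactor β) (suc n)
        P = Π (λ q → s + suc (q * K)) E
        M≡ : β + n ≡ s + E * K
        M≡ = m≡m%n+[m/n]*n (β + n) K
        P≢0 : NonZero P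
        P≢0 = Π-nonZero (λ q → s + suc (q * K)) E λ q → >-nonZero (m≤n⇒m≤o+n s z<s)
        arith₁ : ∀ a b c → a * b * c ≡ b * (a * c)
        arith₁ = solve-∀
        arith₂ : ∀ s E i K → suc s + (E + i) * K ≡ suc (K * i + (s + E * K))
        arith₂ = solve-∀
        shift : ∀ i → suc s + (E + i) * K ≡ suc (K * i + β + n)
        shift i = trans (arith₂ s E i K) (cong suc (trans (cong (K * i +_) (sym M≡)) (sym (+-assoc (K * i) β n))))

      -- Induction on n: the new antidiagonal, with its power of `k`, raises the argument of each
      -- factorial on the right by one, and the new factorial (k n + β)! on the left is (K n + β +
      -- n)!, the missing one with i = n.
      triangle-residueFactor : ∀ n →
        Π (λ j → k ^ ((β + j) / K)) n * triangle (residueFactor β) n * Π (λ i → (k * i + β) !) n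
          ≡ Π (λ i → (K * i + β + n) !) n
      triangle-residueFactor zero    = refl
      triangle-residueFactor (suc n) = begin
        Π pw (suc n) * triangle (residueFactor β) (suc n) * Π F (suc n)
          ≡⟨ cong₂ _*_ (cong₂ _*_ (Π-snoc pw n) (triangle-suc (residueFactor β) n)) (Π-snoc F n) ⟩
        Π pw n * pw n * (triangle (residueFactor β) n * antidiagonal (residueFactor β) (suc n)) * (Π F n * F n)
          ≡⟨ arith₁ (Π pw n) (pw n) (triangle (residueFactor β) n) (antidiagonal (residueFactor β) (suc n)) (Π F n) (F n) ⟩
        pw n * antidiagonal (residueFactor β) (suc n) * (Π pw n * triangle (residueFactor β) n * Π F n * F n)
          ≡⟨ cong₂ _*_ (antidiagonal-residueFactor n) (cong₂ _*_ (triangle-residueFactor n) (cong _! (arith₂ K n β))) ⟩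
        Π (λ i → suc (K * i + β + n)) (suc n) * (Π (λ i → (K * i + β + n) !) n * (K * n + β + n) !)
          ≡⟨ cong (Π (λ i → suc (K * i + β + n)) (suc n) *_) (Π-snoc (λ i → (K * i + β + n) !) n) ⟨
        Π (λ i → suc (K * i + β + n)) (suc n) * Π (λ i → (K * i + β + n) !) (suc n)
          ≡⟨ Π-* (λ i → suc (K * i + β + n)) (λ i → (K * i + β + n) !) (suc n) ⟨
        Π (λ i → (suc (K * i + β + n)) !) (suc n)
          ≡⟨ Π-cong (suc n) (λ i → cong _! (sym (+-suc (K * i + β) n))) ⟩
        Π (λ i → (K * i + β + suc n) !) (suc n) ∎
        where
        pw = λ j → k ^ ((β + j) / K)
        F = λ i → (k * i + β) !
        arith₁ : ∀ a b c d e f → a * b * (c * d) * (e * f) ≡ b * d * (a * c * e * f)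
        arith₁ = solve-∀
        arith₂ : ∀ K n β → suc K * n + β ≡ K * n + β + n
        arith₂ = solve-∀

      -- Let e = (β + j) / K. The integers from k a + β + 1 to k a + β + j + e are the j numbers k a
      -- + B_i together with the e multiples k (a + 1), ..., k (a + e), whose product is k^e (a +
      -- e)! / a!.
      factorial-skipping : ∀ a j →
        (k * a + (β + j) + (β + j) / K) ! * a !
          ≡ k ^ ((β + j) / K) * (k * a + β) ! * Π (λ i → k * a + skipping β i) j * (a + (β + j) / K) !
      factorial-skipping a zero = subst (λ N → Claim N (N / K)) (sym (+-identityʳ β)) base
        where
        Claim : ℕ → ℕ → Set
        Claim N e = (k * a + N + e) ! * a ! ≡ k ^ e * (k * a + β) ! * 1 * (a + e) !
        base : Claim β (β / K)
        base with β ≟ K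
        -- For `β` equal to `K` the multiple k (a + 1) already precedes k a + B_0, so e starts at 1.
        ... | yes β≡K = subst (Claim β) (sym (trans (/-congˡ β≡K) (n/n≡1 K))) (begin
          (k * a + β + 1) ! * a !                     ≡⟨ cong (λ z → z ! * a !) (+-comm (k * a + β) 1) ⟩
          suc (k * a + β) * (k * a + β) ! * a !       ≡⟨ cong (λ z → suc (k * a + z) * (k * a + β) ! * a !) β≡K ⟩
          suc (k * a + K) * (k * a + β) ! * a !       ≡⟨ arith K a ((k * a + β) !) (a !) ⟩
          k * 1 * (k * a + β) ! * 1 * (suc a * a !)   ≡⟨ cong (λ z → k * 1 * (k * a + β) ! * 1 * z !) (+-comm 1 a) ⟩
          k * 1 * (k * a + β) ! * 1 * (a + 1) !       ∎)
          where
          arith : ∀ K a x y → suc (suc K * a + K) * x * y ≡ suc K * 1 * x * 1 * (suc a * y)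
          arith = solve-∀
        ... | no β≢K = subst (Claim β) (sym (m<n⇒m/n≡0 (≤∧≢⇒< β≤K β≢K)))
          (cong₂ _*_ (trans (cong _! (+-identityʳ (k * a + β))) (sym (trans (*-identityʳ _) (+-identityʳ _))))
                     (cong _! (sym (+-identityʳ a))))
      factorial-skipping a (suc j) = step (suc-/ (β + j) K)
        where
        N = β + j
        e = N / K
        Claim : ℕ → ℕ → Set
        Claim N′ e′ = (k * a + N′ + e′) ! * a !
          ≡ k ^ e′ * (k * a + β) ! * Π (λ i → k * a + skipping β i) (suc j) * (a + e′) !
        Q = Π (λ i → k * a + skipping β i) j
        G = (k * a + β) !
        idx : ∀ x N e → x + suc N + e ≡ suc (x + N + e)
        idx = solve-∀
        idx′ : ∀ x N e → suc (x + N + e) ≡ x + suc (N + e)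
        idx′ = solve-∀

        -- The factor k a + B_j is multiplied in with e unchanged; both cases of `step′` begin with
        -- this.
        grow : ∀ {X} → X ≡ Π (λ i → k * a + skipping β i) (suc j) →
          suc (k * a + N + e) * (k * a + N + e) ! * a ! ≡ k ^ e * G * X * (a + e) !
        grow refl = begin
          suc (k * a + N + e) * (k * a + N + e) ! * a !   ≡⟨ *-assoc (suc (k * a + N + e)) ((k * a + N + e) !) (a !) ⟩
          suc (k * a + N + e) * ((k * a + N + e) ! * a !) ≡⟨ cong₂ _*_ (idx′ (k * a) N e) (factorial-skipping a j) ⟩
          (k * a + skipping β j) * (k ^ e * G * Q * (a + e) !) ≡⟨ arith (k * a + skipping β j) (k ^ e * G) Q ((a + e) !) ⟩
          k ^ e * G * (Q * (k * a + skipping β j)) * (a + e) !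
            ≡⟨ cong (λ z → k ^ e * G * z * (a + e) !) (Π-snoc (λ i → k * a + skipping β i) j) ⟨
          k ^ e * G * Π (λ i → k * a + skipping β i) (suc j) * (a + e) ! ∎
          where
          arith : ∀ b g q f → b * (g * q * f) ≡ g * (q * b) * f
          arith = solve-∀

        step : suc N / K ≡ e ⊎ (suc N ≡ suc e * K × suc N / K ≡ suc e) → Claim (β + suc j) ((β + suc j) / K)
        step d rewrite +-suc β j = step′ d
          where
          step′ : suc N / K ≡ e ⊎ (suc N ≡ suc e * K × suc N / K ≡ suc e) → Claim (suc N) (suc N / K)
          step′ (inj₁ p) = subst (Claim (suc N)) (sym p) (trans (cong (λ z → z ! * a !) (idx (k * a) N e)) (grow refl))
          -- Right after k a + B_j comes the multiple k (a + e + 1), which raises both the power of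
          -- `k` and the factorial of a + e.
          step′ (inj₂ (sN , p)) = subst (Claim (suc N)) (sym p) (begin
            (k * a + suc N + suc e) ! * a !
              ≡⟨ cong (λ z → z ! * a !) (trans (+-suc (k * a + suc N) e) (cong suc (idx (k * a) N e))) ⟩
            suc (suc (k * a + N + e)) * (suc (k * a + N + e) * (k * a + N + e) !) * a !
              ≡⟨ *-assoc (suc (suc (k * a + N + e))) (suc (k * a + N + e) * (k * a + N + e) !) (a !) ⟩
            suc (suc (k * a + N + e)) * (suc (k * a + N + e) * (k * a + N + e) ! * a !)
              ≡⟨ cong₂ _*_ (trans (idx₂ (k * a) N e) (trans (cong (λ z → k * a + (z + suc e)) sN) (idx₃ K a e)))
                           (grow refl) ⟩
            k * suc (a + e) * (k ^ e * G * Π (λ i → k * a + skipping β i) (suc j) * (a + e) !)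
              ≡⟨ arith k (suc (a + e)) (k ^ e) G (Π (λ i → k * a + skipping β i) (suc j)) ((a + e) !) ⟩
            k * k ^ e * G * Π (λ i → k * a + skipping β i) (suc j) * (suc (a + e) * (a + e) !)
              ≡⟨ cong (λ z → k * k ^ e * G * Π (λ i → k * a + skipping β i) (suc j) * z !) (sym (+-suc a e)) ⟩
            k * k ^ e * G * Π (λ i → k * a + skipping β i) (suc j) * (a + suc e) ! ∎)
            where
            idx₂ : ∀ x N e → suc (suc (x + N + e)) ≡ x + (suc N + suc e)
            idx₂ = solve-∀
            idx₃ : ∀ K a e → suc K * a + (suc e * K + suc e) ≡ suc K * suc (a + e)
            idx₃ = solve-∀
            arith : ∀ k b p g q f → k * b * (p * g * q * f) ≡ k * p * g * q * (b * f)
            arith = solve-∀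

open NaturalProducts
open import Defs
open import Algebra.Bundles using (CommutativeRing)
import Algebra.Properties.CommutativeMonoid.Sum as CommutativeMonoidSum
open import Data.Fin.Base using (Fin; zero; suc; toℕ; inject; inject₁; fromℕ; punchIn; punchOut)
open import Data.Fin.Induction using (>-weakInduction)
open import Data.Fin.Properties using (_≟_; punchInᵢ≢i; punchIn-injective; punchIn-punchOut; suc-injective; toℕ-inject₁; toℕ-fromℕ; toℕ<n; toℕ-injective)
open import Data.Integer.Base as ℤ using (+_)
import Data.Integer.Properties as ℤ
open import Data.Nat.Base as ℕ using (ℕ; zero; suc; 2+; _∸_; _!; _≤_; _<_; NonZero; NonTrivial)
open import Data.Nat.Combinatorics using (_C_; k![n∸k]!∣n!)
open import Data.Nat.Combinatorics.Specification using (nCk≡n!/k![n-k]!)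
open import Data.Nat.DivMod using (_%_; m≡m%n+[m/n]*n; m%n<n; m/n*n≡m)
open import Data.Nat.Properties as ℕ using (_!≢0; _!*_!≢0)
open import Data.Nat.Tactic.RingSolver using (solve-∀)
open import Data.Product.Base using (_×_; _,_; proj₁; proj₂; ∃-syntax)
open import Data.Rational.Base using (ℚ; _+_; _*_; _-_; -_; _/_; 0ℚ; 1ℚ; fromℚᵘ)
open import Data.Rational.Properties using (+-0-commutativeMonoid; *-1-commutativeMonoid; +-*-commutativeRing; *-zeroʳ; *-identityˡ; +-identityʳ; *-assoc; *-comm; toℚᵘ-injective; toℚᵘ-fromℚᵘ; toℚᵘ-homo-+; toℚᵘ-homo-*; fromℚᵘ-cong)
open import Data.Rational.Solver
open import Data.Rational.Unnormalised.Base as ℚᵘ using (mkℚᵘ; *≡*)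
import Data.Rational.Unnormalised.Properties as ℚᵘ
open import Data.Sum.Base using (_⊎_; inj₁; inj₂)
open import Data.Vec.Functional using (updateAt)
open import Data.Vec.Functional.Properties using (updateAt-updates; updateAt-minimal)
open import Function.Base using (_∘_; const)
open import Relation.Binary.PropositionalEquality using (_≡_; _≢_; refl; sym; trans; cong; cong₂; subst; module ≡-Reasoning)
open import Relation.Nullary using (yes; no; contradiction)
open +-*-Solver
open ≡-Reasoning
open import Algebra.Properties.Semiring.Sum (CommutativeRing.semiring +-*-commutativeRing) using (*-distribˡ-sum)

-- Determinants

module ∑ = CommutativeMonoidSum +-0-commutativeMonoid
module ∏ = CommutativeMonoidSum *-1-commutativeMonoid

private
  variable
    m n : ℕ

Matrix : ℕ → ℕ → Set
Matrix m n = Fin m → Fin n → ℚ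

minor : Matrix (suc m) (suc n) → Fin (suc n) → Matrix m n
minor A j r c = A (suc r) (punchIn j c)

cofactorTerm : Matrix (suc n) (suc n) → Fin (suc n) → ℚ
cofactorTerm A j = (- 1ℚ) ^ toℕ j * A zero j * det (minor A j)

det-cong : {A B : Matrix n n} → (∀ i j → A i j ≡ B i j) → det A ≡ det B
det-cong {zero}  A≗B = refl
det-cong {suc n} A≗B = ∑.sum-cong-≗ λ j →
  cong₂ _*_ (cong ((- 1ℚ) ^ toℕ j *_) (A≗B zero j))
            (det-cong λ r c → A≗B (suc r) (punchIn j c))

det-scaleRows : (w : Fin n → ℚ) (A : Matrix n n) →
  det (λ i j → w i * A i j) ≡ product w * det A
det-scaleRows {zero}  w A = refl
det-scaleRows {suc n} w A = begin
  ∑.sum (cofactorTerm λ i j → w i * A i j)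
    ≡⟨ ∑.sum-cong-≗ (λ j → trans
         (cong ((- 1ℚ) ^ toℕ j * (w zero * A zero j) *_) (det-scaleRows (w ∘ suc) (minor A j)))
         (solve 5 (λ s w₀ a W d → s :* (w₀ :* a) :* (W :* d) := w₀ :* W :* (s :* a :* d)) refl
           ((- 1ℚ) ^ toℕ j) (w zero) (A zero j) (product (w ∘ suc)) (det (minor A j)))) ⟩
  ∑.sum (λ j → product w * cofactorTerm A j)
    ≡⟨ *-distribˡ-sum (product w) (cofactorTerm A) ⟨
  product w * det A ∎

det-scaleColumns : (g : Fin n → ℚ) (A : Matrix n n) →
  det (λ i j → g j * A i j) ≡ product g * det A
det-scaleColumns {zero}  g A = refl
det-scaleColumns {suc n} g A = begin
  ∑.sum (cofactorTerm λ i j → g j * A i j)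
    ≡⟨ ∑.sum-cong-≗ term ⟩
  ∑.sum (λ j → product g * cofactorTerm A j)
    ≡⟨ *-distribˡ-sum (product g) (cofactorTerm A) ⟨
  product g * det A ∎
  where
  term : ∀ j → cofactorTerm (λ i j → g j * A i j) j ≡ product g * cofactorTerm A j
  term j = begin
    s * (g j * A zero j) * det (minor (λ i j → g j * A i j) j)
      ≡⟨ cong (s * (g j * A zero j) *_) (det-scaleColumns (g ∘ punchIn j) (minor A j)) ⟩
    s * (g j * A zero j) * (product (g ∘ punchIn j) * det (minor A j))
      ≡⟨ solve 5 (λ s w₀ a W d → s :* (w₀ :* a) :* (W :* d) := w₀ :* W :* (s :* a :* d)) refl
           s (g j) (A zero j) (product (g ∘ punchIn j)) (det (minor A j)) ⟩
    g j * product (g ∘ punchIn j) * cofactorTerm A j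
      ≡⟨ cong (_* cofactorTerm A j) (∏.sum-remove {i = j} g) ⟨
    product g * cofactorTerm A j ∎
    where s = (- 1ℚ) ^ toℕ j

-- In the expansion along the first row, the term of column `t` has a linear entry and a common
-- minor; every other term has a common entry and a minor that is linear, by induction, in the
-- surviving copy of column `t`.
det-linear : (A B X : Matrix n n) (t : Fin n) (d e : ℚ) →
  (∀ i → X i t ≡ d * A i t + e * B i t) →
  (∀ i j → j ≢ t → X i j ≡ A i j) →
  (∀ i j → j ≢ t → X i j ≡ B i j) →
  det X ≡ d * det A + e * det B
det-linear {suc n} A B X t d e Ct CA CB = begin
  ∑.sum (cofactorTerm X)
    ≡⟨ ∑.sum-cong-≗ term ⟩
  ∑.sum (λ j → d * cofactorTerm A j + e * cofactorTerm B j)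
    ≡⟨ ∑.∑-distrib-+ (λ j → d * cofactorTerm A j) (λ j → e * cofactorTerm B j) ⟩
  ∑.sum (λ j → d * cofactorTerm A j) + ∑.sum (λ j → e * cofactorTerm B j)
    ≡⟨ cong₂ _+_ (*-distribˡ-sum d (cofactorTerm A)) (*-distribˡ-sum e (cofactorTerm B)) ⟨
  d * det A + e * det B ∎
  where
  term : ∀ j → cofactorTerm X j ≡ d * cofactorTerm A j + e * cofactorTerm B j
  term j with j ≟ t
  ... | yes refl = begin
    s * X zero j * det (minor X j)
      ≡⟨ cong (λ c → s * c * det (minor X j)) (Ct zero) ⟩
    s * (d * A zero j + e * B zero j) * det (minor X j)
      ≡⟨ solve 6 (λ s d a e b M → s :* (d :* a :+ e :* b) :* M := d :* (s :* a :* M) :+ e :* (s :* b :* M)) refl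
           s d (A zero j) e (B zero j) (det (minor X j)) ⟩
    d * (s * A zero j * det (minor X j)) + e * (s * B zero j * det (minor X j))
      ≡⟨ cong₂ (λ M N → d * (s * A zero j * M) + e * (s * B zero j * N))
           (det-cong λ r c → CA (suc r) (punchIn j c) (punchInᵢ≢i j c))
           (det-cong λ r c → CB (suc r) (punchIn j c) (punchInᵢ≢i j c)) ⟩
    d * cofactorTerm A j + e * cofactorTerm B j ∎
    where s = (- 1ℚ) ^ toℕ j
  ... | no j≢t = begin
    s * X zero j * det (minor X j)
      ≡⟨ cong (s * X zero j *_) (det-linear (minor A j) (minor B j) (minor X j) t′ d e
           (λ i → subst (λ u → X (suc i) u ≡ d * A (suc i) u + e * B (suc i) u) (sym t≡) (Ct (suc i)))
           (λ i c c≢ → CA (suc i) (punchIn j c) (≢t c≢))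
           (λ i c c≢ → CB (suc i) (punchIn j c) (≢t c≢))) ⟩
    s * X zero j * (d * det (minor A j) + e * det (minor B j))
      ≡⟨ solve 6 (λ s a d M e N → s :* a :* (d :* M :+ e :* N) := d :* (s :* a :* M) :+ e :* (s :* a :* N)) refl
           s (X zero j) d (det (minor A j)) e (det (minor B j)) ⟩
    d * (s * X zero j * det (minor A j)) + e * (s * X zero j * det (minor B j))
      ≡⟨ cong₂ (λ a b → d * (s * a * det (minor A j)) + e * (s * b * det (minor B j)))
           (CA zero j j≢t) (CB zero j j≢t) ⟩
    d * cofactorTerm A j + e * cofactorTerm B j ∎
    where
    s = (- 1ℚ) ^ toℕ j
    t′ = punchOut j≢t
    t≡ : punchIn j t′ ≡ t
    t≡ = punchIn-punchOut j≢t
    ≢t : ∀ {c} → c ≢ t′ → punchIn j c ≢ t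
    ≢t {c} c≢ eq = c≢ (punchIn-injective j c t′ (trans eq (sym t≡)))

sum-adjacent : (f : Fin (suc n) → ℚ) (t : Fin n) → f (inject₁ t) + f (suc t) ≡ 0ℚ →
  (∀ j → j ≢ inject₁ t → j ≢ suc t → f j ≡ 0ℚ) → sum f ≡ 0ℚ
sum-adjacent {suc n} f zero pair rest = begin
  f zero + (f (suc zero) + sum (λ j → f (suc (suc j))))
    ≡⟨ cong (λ z → f zero + (f (suc zero) + z))
         (trans (∑.sum-cong-≗ λ j → rest (suc (suc j)) (λ ()) (λ ())) (∑.sum-replicate-zero n)) ⟩
  f zero + (f (suc zero) + 0ℚ)  ≡⟨ cong (λ z → f zero + z) (+-identityʳ (f (suc zero))) ⟩
  f zero + f (suc zero)         ≡⟨ pair ⟩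
  0ℚ                            ∎
sum-adjacent {suc n} f (suc t) pair rest = begin
  f zero + sum (f ∘ suc)
    ≡⟨ cong₂ _+_ (rest zero (λ ()) (λ ()))
         (sum-adjacent (f ∘ suc) t pair λ j j≢ j≢′ → rest (suc j) (j≢ ∘ suc-injective) (j≢′ ∘ suc-injective)) ⟩
  0ℚ ∎

-- Keeps two equal neighbouring columns adjacent in every minor that contains both, so that
-- induction applies to that minor.
punchIn-adjacent : (j : Fin (suc (suc n))) (t : Fin (suc n)) → j ≢ inject₁ t → j ≢ suc t →
  ∃[ t′ ] punchIn j (inject₁ t′) ≡ inject₁ t × punchIn j (suc t′) ≡ suc t
punchIn-adjacent zero zero j≢ _ = contradiction refl j≢
punchIn-adjacent zero (suc t) _ _ = t , refl , refl
punchIn-adjacent (suc zero) zero _ j≢ = contradiction refl j≢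
punchIn-adjacent {suc n} (suc (suc j)) zero _ _ = zero , refl , refl
punchIn-adjacent {suc n} (suc j) (suc t) j≢ j≢′
  with punchIn-adjacent j t (j≢ ∘ cong suc) (j≢′ ∘ cong suc)
... | t′ , p , q = suc t′ , cong suc p , cong suc q

-- The two minors omitting one of two neighbouring columns differ only where the other one stands;
-- they coincide when the two columns are equal.
punchIn-inject₁-suc : (t c : Fin n) →
  punchIn (inject₁ t) c ≡ punchIn (suc t) c ⊎
  (punchIn (inject₁ t) c ≡ suc t × punchIn (suc t) c ≡ inject₁ t)
punchIn-inject₁-suc zero    zero    = inj₂ (refl , refl)
punchIn-inject₁-suc zero    (suc c) = inj₁ refl
punchIn-inject₁-suc (suc t) zero    = inj₁ refl
punchIn-inject₁-suc (suc t) (suc c) with punchIn-inject₁-suc t c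
... | inj₁ p       = inj₁ (cong suc p)
... | inj₂ (p , q) = inj₂ (cong suc p , cong suc q)

-- In the first-row expansion the terms of the two equal columns have the same entry and minor but
-- opposite signs; all other minors still contain both columns and vanish by induction.
det-adjacentEqual : (A : Matrix (suc n) (suc n)) (t : Fin n) →
  (∀ i → A i (inject₁ t) ≡ A i (suc t)) → det A ≡ 0ℚ
det-adjacentEqual {suc n} A t eq = sum-adjacent (cofactorTerm A) t cancel vanish
  where
  s = (- 1ℚ) ^ toℕ t
  minors : det (minor A (inject₁ t)) ≡ det (minor A (suc t))
  minors = det-cong λ r c → entry r c (punchIn-inject₁-suc t c)
    where
    entry : ∀ r c → punchIn (inject₁ t) c ≡ punchIn (suc t) c ⊎
      (punchIn (inject₁ t) c ≡ suc t × punchIn (suc t) c ≡ inject₁ t) →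
      minor A (inject₁ t) r c ≡ minor A (suc t) r c
    entry r c (inj₁ p)       = cong (A (suc r)) p
    entry r c (inj₂ (p , q)) = begin
      A (suc r) (punchIn (inject₁ t) c) ≡⟨ cong (A (suc r)) p ⟩
      A (suc r) (suc t)                 ≡⟨ eq (suc r) ⟨
      A (suc r) (inject₁ t)             ≡⟨ cong (A (suc r)) q ⟨
      A (suc r) (punchIn (suc t) c)     ∎

  cancel : cofactorTerm A (inject₁ t) + cofactorTerm A (suc t) ≡ 0ℚ
  cancel = begin
    (- 1ℚ) ^ toℕ (inject₁ t) * A zero (inject₁ t) * det (minor A (inject₁ t)) + cofactorTerm A (suc t)
      ≡⟨ cong (_+ cofactorTerm A (suc t)) (cong₂ _*_ (cong₂ (λ e a → (- 1ℚ) ^ e * a) (toℕ-inject₁ t) (eq zero)) minors) ⟩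
    s * A zero (suc t) * det (minor A (suc t)) + (- 1ℚ) * s * A zero (suc t) * det (minor A (suc t))
      ≡⟨ solve 3 (λ s a d → s :* a :* d :+ con (- 1ℚ) :* s :* a :* d := con 0ℚ) refl
           s (A zero (suc t)) (det (minor A (suc t))) ⟩
    0ℚ ∎

  vanish : ∀ j → j ≢ inject₁ t → j ≢ suc t → cofactorTerm A j ≡ 0ℚ
  vanish j j≢ j≢′ with punchIn-adjacent j t j≢ j≢′
  ... | t′ , p , q = begin
    (- 1ℚ) ^ toℕ j * A zero j * det (minor A j)
      ≡⟨ cong ((- 1ℚ) ^ toℕ j * A zero j *_) (det-adjacentEqual (minor A j) t′ λ i →
           trans (cong (A (suc i)) p) (trans (eq (suc i)) (cong (A (suc i)) (sym q)))) ⟩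
    (- 1ℚ) ^ toℕ j * A zero j * 0ℚ
      ≡⟨ *-zeroʳ ((- 1ℚ) ^ toℕ j * A zero j) ⟩
    0ℚ ∎

det-firstRow : (A : Matrix (suc n) (suc n)) → (∀ j → A zero (suc j) ≡ 0ℚ) →
  det A ≡ A zero zero * det (λ i j → A (suc i) (suc j))
det-firstRow {n} A zeros = begin
  cofactorTerm A zero + sum (cofactorTerm A ∘ suc)
    ≡⟨ cong (λ z → cofactorTerm A zero + z) (trans (∑.sum-cong-≗ vanish) (∑.sum-replicate-zero n)) ⟩
  1ℚ * A zero zero * det (minor A zero) + 0ℚ
    ≡⟨ solve 2 (λ a d → con 1ℚ :* a :* d :+ con 0ℚ := a :* d) refl (A zero zero) (det (minor A zero)) ⟩
  A zero zero * det (minor A zero) ∎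
  where
  vanish : ∀ j → cofactorTerm A (suc j) ≡ 0ℚ
  vanish j = begin
    s * A zero (suc j) * det (minor A (suc j)) ≡⟨ cong (λ a → s * a * det (minor A (suc j))) (zeros j) ⟩
    s * 0ℚ * det (minor A (suc j))
      ≡⟨ solve 2 (λ s d → s :* con 0ℚ :* d := con 0ℚ) refl s (det (minor A (suc j))) ⟩
    0ℚ ∎
    where s = (- 1ℚ) ^ toℕ (suc j)

-- Combining columns with their left neighbours

combineColumns : (d e : Fin n → ℚ) → Matrix m (suc n) → Matrix m (suc n)
combineColumns d e A i zero    = A i zero
combineColumns d e A i (suc j) = d j * A i (suc j) - e j * A i (inject₁ j)

product-updateAt-1 : (d : Fin n → ℚ) (t : Fin n) → product d ≡ d t * product (updateAt d t (const 1ℚ))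
product-updateAt-1 {suc n} d t = begin
  product d                                  ≡⟨ ∏.sum-remove {i = t} d ⟩
  d t * product (d ∘ punchIn t)
    ≡⟨ cong (d t *_) (∏.sum-cong-≗ λ c → updateAt-minimal (punchIn t c) t d (punchInᵢ≢i t c)) ⟨
  d t * product (d′ ∘ punchIn t)             ≡⟨ cong (d t *_) (*-identityˡ (product (d′ ∘ punchIn t))) ⟨
  d t * (1ℚ * product (d′ ∘ punchIn t))
    ≡⟨ cong (λ z → d t * (z * product (d′ ∘ punchIn t))) (updateAt-updates t d) ⟨
  d t * (d′ t * product (d′ ∘ punchIn t))    ≡⟨ cong (d t *_) (∏.sum-remove {i = t} d′) ⟨
  d t * product d′                           ∎
  where d′ = updateAt d t (const 1ℚ)

-- The columns are replaced from right to left, so that the column to the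
-- left of the one being replaced is still the original one.
det-combineColumns : (d e : Fin n → ℚ) (A : Matrix (suc n) (suc n)) →
  det (combineColumns d e A) ≡ product d * det A
det-combineColumns {n} d e A = >-weakInduction P base step zero d e (λ _ ())
  where
  TrivialBelow : ℕ → (Fin n → ℚ) → (Fin n → ℚ) → Set
  TrivialBelow s d e = ∀ j → toℕ j < s → d j ≡ 1ℚ × e j ≡ 0ℚ

  -- Downward induction on `s`: coefficients below `s` leave their columns alone. At `s` = n nothing
  -- changes, and at `s` = 0 there is no restriction on `d` and `e`.
  P : Fin (suc n) → Set
  P s = ∀ d e → TrivialBelow (toℕ s) d e → det (combineColumns d e A) ≡ product d * det A

  unchanged : ∀ d e i j → d j ≡ 1ℚ × e j ≡ 0ℚ → combineColumns d e A i (suc j) ≡ A i (suc j)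
  unchanged d e i j (dj , ej) = begin
    d j * A i (suc j) - e j * A i (inject₁ j) ≡⟨ cong₂ (λ x y → x * A i (suc j) - y * A i (inject₁ j)) dj ej ⟩
    1ℚ * A i (suc j) - 0ℚ * A i (inject₁ j)
      ≡⟨ solve 2 (λ x y → con 1ℚ :* x :- con 0ℚ :* y := x) refl (A i (suc j)) (A i (inject₁ j)) ⟩
    A i (suc j)                               ∎

  base : P (fromℕ n)
  base d e triv = begin
    det (combineColumns d e A)  ≡⟨ det-cong same ⟩
    det A                       ≡⟨ *-identityˡ (det A) ⟨
    1ℚ * det A                  ≡⟨ cong (_* det A) (trans (∏.sum-cong-≗ (proj₁ ∘ all)) (∏.sum-replicate-zero n)) ⟨
    product d * det A           ∎
    where
    all : ∀ j → d j ≡ 1ℚ × e j ≡ 0ℚ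
    all j = triv j (subst (toℕ j <_) (sym (toℕ-fromℕ n)) (toℕ<n j))
    same : ∀ i j → combineColumns d e A i j ≡ A i j
    same i zero    = refl
    same i (suc j) = unchanged d e i j (all j)

  step : ∀ t → P (suc t) → P (inject₁ t)
  step t IH d e triv = begin
    det (combineColumns d e A)
      ≡⟨ det-linear (combineColumns d′ e′ A) Z (combineColumns d e A) (suc t) (d t) (- e t) at-t off-t
           (λ i j j≢ → sym (updateAt-minimal j (suc t) (combineColumns d e A i) j≢)) ⟩
    d t * det (combineColumns d′ e′ A) + - e t * det Z
      ≡⟨ cong₂ (λ x y → d t * x + - e t * y) (IH d′ e′ triv′) (det-adjacentEqual Z t Z-equal) ⟩
    d t * (product d′ * det A) + - e t * 0ℚ
      ≡⟨ solve 4 (λ d D a e → d :* (D :* a) :+ :- e :* con 0ℚ := d :* D :* a) refl (d t) (product d′) (det A) (e t) ⟩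
    d t * product d′ * det A
      ≡⟨ cong (_* det A) (product-updateAt-1 d t) ⟨
    product d * det A ∎
    where
    d′ = updateAt d t (const 1ℚ)
    e′ = updateAt e t (const 0ℚ)
    -- `Z` isolates the subtracted part of column `suc t`. Column `inject₁ t` is still the original
    -- one because the coefficients below `t` are trivial, so `Z` has two equal neighbouring
    -- columns.
    Z : Matrix (suc n) (suc n)
    Z i = updateAt (combineColumns d e A i) (suc t) (const (A i (inject₁ t)))

    below : ∀ j → toℕ j < toℕ t → d j ≡ 1ℚ × e j ≡ 0ℚ
    below j j<t = triv j (subst (toℕ j <_) (sym (toℕ-inject₁ t)) j<t)

    triv′ : TrivialBelow (suc (toℕ t)) d′ e′
    triv′ j j<1+t with j ≟ t
    ... | yes refl = updateAt-updates t d , updateAt-updates t e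
    ... | no j≢t = trans (updateAt-minimal j t d j≢t) (proj₁ dej) , trans (updateAt-minimal j t e j≢t) (proj₂ dej)
      where dej = below j (ℕ.≤∧≢⇒< (ℕ.s≤s⁻¹ j<1+t) (j≢t ∘ toℕ-injective))

    at-t : ∀ i → combineColumns d e A i (suc t) ≡ d t * combineColumns d′ e′ A i (suc t) + - e t * Z i (suc t)
    at-t i = begin
      d t * A i (suc t) - e t * A i (inject₁ t)
        ≡⟨ solve 4 (λ d a e b → d :* a :- e :* b := d :* a :+ :- e :* b) refl (d t) (A i (suc t)) (e t) (A i (inject₁ t)) ⟩
      d t * A i (suc t) + - e t * A i (inject₁ t)
        ≡⟨ cong₂ (λ x y → d t * x + - e t * y)
             (unchanged d′ e′ i t (triv′ t (ℕ.n<1+n (toℕ t)))) (updateAt-updates (suc t) (combineColumns d e A i)) ⟨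
      d t * combineColumns d′ e′ A i (suc t) + - e t * Z i (suc t) ∎

    off-t : ∀ i j → j ≢ suc t → combineColumns d e A i j ≡ combineColumns d′ e′ A i j
    off-t i zero    _  = refl
    off-t i (suc j) j≢ = cong₂ (λ x y → x * A i (suc j) - y * A i (inject₁ j))
      (sym (updateAt-minimal j t d (j≢ ∘ cong suc))) (sym (updateAt-minimal j t e (j≢ ∘ cong suc)))

    original : ∀ i (u : Fin n) → (∀ j → toℕ j < toℕ u → d j ≡ 1ℚ × e j ≡ 0ℚ) →
      combineColumns d e A i (inject₁ u) ≡ A i (inject₁ u)
    original i zero    _     = refl
    original i (suc u) below = unchanged d e i (inject₁ u) (below (inject₁ u) (≡⇒<suc (toℕ-inject₁ u)))
      where
      ≡⇒<suc : ∀ {a b} → a ≡ b → a < suc b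
      ≡⇒<suc refl = ℕ.n<1+n _

    inject₁≢suc : ∀ {n} (u : Fin n) → inject₁ u ≢ suc u
    inject₁≢suc (suc u) eq = inject₁≢suc u (suc-injective eq)

    Z-equal : ∀ i → Z i (inject₁ t) ≡ Z i (suc t)
    Z-equal i = begin
      Z i (inject₁ t)                      ≡⟨ updateAt-minimal (inject₁ t) (suc t) (combineColumns d e A i) (inject₁≢suc t) ⟩
      combineColumns d e A i (inject₁ t)   ≡⟨ original i t below ⟩
      A i (inject₁ t)                      ≡⟨ updateAt-updates (suc t) (combineColumns d e A i) ⟨
      Z i (suc t)                          ∎

-- Natural numbers as rationals

fromℚᵘ-+ : ∀ p q → fromℚᵘ (p ℚᵘ.+ q) ≡ fromℚᵘ p + fromℚᵘ q
fromℚᵘ-+ p q = toℚᵘ-injective (ℚᵘ.≃-trans (toℚᵘ-fromℚᵘ (p ℚᵘ.+ q)) (ℚᵘ.≃-sym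
  (ℚᵘ.≃-trans (toℚᵘ-homo-+ (fromℚᵘ p) (fromℚᵘ q)) (ℚᵘ.+-cong (toℚᵘ-fromℚᵘ p) (toℚᵘ-fromℚᵘ q)))))

fromℚᵘ-* : ∀ p q → fromℚᵘ (p ℚᵘ.* q) ≡ fromℚᵘ p * fromℚᵘ q
fromℚᵘ-* p q = toℚᵘ-injective (ℚᵘ.≃-trans (toℚᵘ-fromℚᵘ (p ℚᵘ.* q)) (ℚᵘ.≃-sym
  (ℚᵘ.≃-trans (toℚᵘ-homo-* (fromℚᵘ p) (fromℚᵘ q)) (ℚᵘ.*-cong (toℚᵘ-fromℚᵘ p) (toℚᵘ-fromℚᵘ q)))))

ι : ℕ → ℚ
ι n = + n / 1

/1-+ : ∀ z w → (z ℤ.+ w) / 1 ≡ z / 1 + w / 1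
/1-+ z w = begin
  (z ℤ.+ w) / 1                                  ≡⟨ cong (_/ 1) (cong₂ ℤ._+_ (ℤ.*-identityʳ z) (ℤ.*-identityʳ w)) ⟨
  fromℚᵘ (mkℚᵘ z 0 ℚᵘ.+ mkℚᵘ w 0)                ≡⟨ fromℚᵘ-+ (mkℚᵘ z 0) (mkℚᵘ w 0) ⟩
  z / 1 + w / 1                                  ∎

ι-+ : ∀ m n → ι (m ℕ.+ n) ≡ ι m + ι n
ι-+ m n = /1-+ (+ m) (+ n)

ι-* : ∀ m n → ι (m ℕ.* n) ≡ ι m * ι n
ι-* m n = trans (cong (_/ 1) (ℤ.pos-* m n)) (fromℚᵘ-* (mkℚᵘ (+ m) 0) (mkℚᵘ (+ n) 0))

/1-- : ∀ m n → (+ m ℤ.- + n) / 1 ≡ ι m - ι n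
/1-- m n = begin
  z                ≡⟨ solve 2 (λ z n → z := z :+ n :- n) refl z (ι n) ⟩
  z + ι n - ι n    ≡⟨ cong (_- ι n) (/1-+ (+ m ℤ.- + n) (+ n)) ⟨
  (+ m ℤ.- + n ℤ.+ + n) / 1 - ι n
    ≡⟨ cong (λ w → w / 1 - ι n) (trans (ℤ.+-assoc (+ m) (ℤ.- + n) (+ n))
         (trans (cong (λ z → + m ℤ.+ z) (ℤ.+-inverseˡ (+ n))) (ℤ.+-identityʳ (+ m)))) ⟩
  ι m - ι n        ∎
  where z = (+ m ℤ.- + n) / 1

/-*-cancel : ∀ z d .{{_ : NonZero d}} → (z / d) * ι d ≡ z / 1
/-*-cancel z d@(suc d-1) = begin
  (z / d) * ι d                            ≡⟨ fromℚᵘ-* (mkℚᵘ z d-1) (mkℚᵘ (+ d) 0) ⟨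
  fromℚᵘ (mkℚᵘ z d-1 ℚᵘ.* mkℚᵘ (+ d) 0)
    ≡⟨ fromℚᵘ-cong {mkℚᵘ z d-1 ℚᵘ.* mkℚᵘ (+ d) 0} {mkℚᵘ z 0} (*≡* (trans (ℤ.*-identityʳ (z ℤ.* + d)) (cong (λ w → z ℤ.* + w) (sym (ℕ.*-identityʳ d))))) ⟩
  z / 1                                    ∎

*-cancelˡ-ι : ∀ d .{{_ : NonZero d}} {x y} → ι d * x ≡ ι d * y → x ≡ y
*-cancelˡ-ι d {x} {y} eq = begin
  x                       ≡⟨ undo x ⟨
  (+ 1 / d) * (ι d * x)   ≡⟨ cong ((+ 1 / d) *_) eq ⟩
  (+ 1 / d) * (ι d * y)   ≡⟨ undo y ⟩
  y                       ∎
  where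
  undo : ∀ x → (+ 1 / d) * (ι d * x) ≡ x
  undo x = trans (sym (*-assoc (+ 1 / d) (ι d) x)) (trans (cong (_* x) (/-*-cancel (+ 1) d)) (*-identityˡ x))

*-cancelˡ-product-ι : ∀ {n} (D : Fin n → ℕ) → (∀ i → NonZero (D i)) → ∀ {x y} →
  product (ι ∘ D) * x ≡ product (ι ∘ D) * y → x ≡ y
*-cancelˡ-product-ι {zero}  D nz {x} {y} eq = trans (sym (*-identityˡ x)) (trans eq (*-identityˡ y))
*-cancelˡ-product-ι {suc n} D nz {x} {y} eq = *-cancelˡ-product-ι (D ∘ suc) (nz ∘ suc)
  (*-cancelˡ-ι (D zero) {{nz zero}} (trans (sym (*-assoc (ι (D zero)) _ x)) (trans eq (*-assoc (ι (D zero)) _ y))))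

product-ι : ∀ f n → product {n} (ι ∘ f ∘ toℕ) ≡ ι (Π f n)
product-ι f zero    = refl
product-ι f (suc n) = trans (cong (ι (f 0) *_) (product-ι (f ∘ suc) n)) (sym (ι-* (f 0) _))

-- Krattenthaler's determinant, with linear forms of two different slopes

module _ (K k : ℕ) where

  -- The polynomial p_j: stripping both sequences together keeps the remaining forms of slope `K` at
  -- their original indices, starting from `A j`.
  splitProduct : (A B : ℕ → ℕ) (m : ℕ) → Fin (suc m) → ℕ → ℕ
  splitProduct A B m       zero    x = Π (λ i → K ℕ.* x ℕ.+ A i) m
  splitProduct A B (suc m) (suc j) x = (k ℕ.* x ℕ.+ B 0) ℕ.* splitProduct (A ∘ suc) (B ∘ suc) m j x

  -- (K y + A j) p (j + 1) x − (k y + B j) p j x = (x − y) h p′ j x, where p uses A and p′ uses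
  -- A ∘ suc, with the subtrahends moved to the other side.
  splitProduct-step : ∀ A B m (j : Fin (suc m)) h → h ℕ.+ K ℕ.* B (toℕ j) ≡ k ℕ.* A (toℕ j) → ∀ x y →
    (K ℕ.* y ℕ.+ A (toℕ j)) ℕ.* splitProduct A B (suc m) (suc j) x ℕ.+ y ℕ.* (h ℕ.* splitProduct (A ∘ suc) B m j x)
      ≡ (k ℕ.* y ℕ.+ B (toℕ j)) ℕ.* splitProduct A B (suc m) (inject₁ j) x ℕ.+ x ℕ.* (h ℕ.* splitProduct (A ∘ suc) B m j x)
  -- Apart from the common factor `P` this is (K y + a) (k x + b) - (k y + b) (K x + a) = (x - y) (k
  -- a - K b).
  splitProduct-step A B m zero h h≡ x y = begin
    (K ℕ.* y ℕ.+ a) ℕ.* ((k ℕ.* x ℕ.+ b) ℕ.* P) ℕ.+ y ℕ.* (h ℕ.* P)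
      ≡⟨ arith₁ K k x y a b h P ⟩
    (K ℕ.* k ℕ.* x ℕ.* y ℕ.+ a ℕ.* b ℕ.+ x ℕ.* (k ℕ.* a) ℕ.+ y ℕ.* (h ℕ.+ K ℕ.* b)) ℕ.* P
      ≡⟨ cong₂ (λ u v → (K ℕ.* k ℕ.* x ℕ.* y ℕ.+ a ℕ.* b ℕ.+ x ℕ.* u ℕ.+ y ℕ.* v) ℕ.* P) (sym h≡) h≡ ⟩
    (K ℕ.* k ℕ.* x ℕ.* y ℕ.+ a ℕ.* b ℕ.+ x ℕ.* (h ℕ.+ K ℕ.* b) ℕ.+ y ℕ.* (k ℕ.* a)) ℕ.* P
      ≡⟨ arith₂ K k x y a b h P ⟩
    (k ℕ.* y ℕ.+ b) ℕ.* ((K ℕ.* x ℕ.+ a) ℕ.* P) ℕ.+ x ℕ.* (h ℕ.* P) ∎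
    where
    a = A 0
    b = B 0
    P = Π (λ i → K ℕ.* x ℕ.+ A (suc i)) m
    arith₁ : ∀ K k x y a b h P → (K ℕ.* y ℕ.+ a) ℕ.* ((k ℕ.* x ℕ.+ b) ℕ.* P) ℕ.+ y ℕ.* (h ℕ.* P)
      ≡ (K ℕ.* k ℕ.* x ℕ.* y ℕ.+ a ℕ.* b ℕ.+ x ℕ.* (k ℕ.* a) ℕ.+ y ℕ.* (h ℕ.+ K ℕ.* b)) ℕ.* P
    arith₁ = solve-∀
    arith₂ : ∀ K k x y a b h P → (K ℕ.* k ℕ.* x ℕ.* y ℕ.+ a ℕ.* b ℕ.+ x ℕ.* (h ℕ.+ K ℕ.* b) ℕ.+ y ℕ.* (k ℕ.* a)) ℕ.* P
      ≡ (k ℕ.* y ℕ.+ b) ℕ.* ((K ℕ.* x ℕ.+ a) ℕ.* P) ℕ.+ x ℕ.* (h ℕ.* P)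
    arith₂ = solve-∀
  splitProduct-step A B (suc m) (suc j) h h≡ x y = begin
    u ℕ.* (f ℕ.* p) ℕ.+ y ℕ.* (h ℕ.* (f ℕ.* c))   ≡⟨ arith u f p y h c ⟩
    f ℕ.* (u ℕ.* p ℕ.+ y ℕ.* (h ℕ.* c))
      ≡⟨ cong (f ℕ.*_) (splitProduct-step (A ∘ suc) (B ∘ suc) m j h h≡ x y) ⟩
    f ℕ.* (v ℕ.* q ℕ.+ x ℕ.* (h ℕ.* c))           ≡⟨ arith v f q x h c ⟨
    v ℕ.* (f ℕ.* q) ℕ.+ x ℕ.* (h ℕ.* (f ℕ.* c))   ∎
    where
    u = K ℕ.* y ℕ.+ A (suc (toℕ j))
    v = k ℕ.* y ℕ.+ B (suc (toℕ j))
    f = k ℕ.* x ℕ.+ B 0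
    p = splitProduct (A ∘ suc) (B ∘ suc) (suc m) (suc j) x
    q = splitProduct (A ∘ suc) (B ∘ suc) (suc m) (inject₁ j) x
    c = splitProduct (λ i → A (suc (suc i))) (B ∘ suc) m j x
    arith : ∀ u f p y h c → u ℕ.* (f ℕ.* p) ℕ.+ y ℕ.* (h ℕ.* (f ℕ.* c)) ≡ f ℕ.* (u ℕ.* p ℕ.+ y ℕ.* (h ℕ.* c))
    arith = solve-∀

  -- When the forms of slope `K` take consecutive values from c + 1 on, those with index at least j
  -- multiply to (c + m)! / (c + j)!.
  splitProduct-! : ∀ A B m (j : Fin (suc m)) x c → (∀ i → K ℕ.* x ℕ.+ A i ≡ suc (c ℕ.+ i)) →
    splitProduct A B m j x ℕ.* (c ℕ.+ toℕ j) ! ≡ Π (λ i → k ℕ.* x ℕ.+ B i) (toℕ j) ℕ.* (c ℕ.+ m) !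
  splitProduct-! A B zero zero x c eq = refl
  splitProduct-! A B (suc m) zero x c eq = begin
    (K ℕ.* x ℕ.+ A 0) ℕ.* Q ℕ.* (c ℕ.+ 0) !     ≡⟨ arith (K ℕ.* x ℕ.+ A 0) Q ((c ℕ.+ 0) !) ⟩
    Q ℕ.* ((K ℕ.* x ℕ.+ A 0) ℕ.* (c ℕ.+ 0) !)   ≡⟨ cong (λ z → Q ℕ.* (z ℕ.* (c ℕ.+ 0) !)) (eq 0) ⟩
    Q ℕ.* (suc c ℕ.+ 0) !
      ≡⟨ splitProduct-! (A ∘ suc) B m zero x (suc c) (λ i → trans (eq (suc i)) (cong suc (ℕ.+-suc c i))) ⟩
    1 ℕ.* (suc c ℕ.+ m) !                       ≡⟨ cong (λ z → 1 ℕ.* z !) (sym (ℕ.+-suc c m)) ⟩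
    1 ℕ.* (c ℕ.+ suc m) !                       ∎
    where
    Q = Π (λ i → K ℕ.* x ℕ.+ A (suc i)) m
    arith : ∀ a q f → a ℕ.* q ℕ.* f ≡ q ℕ.* (a ℕ.* f)
    arith = solve-∀
  splitProduct-! A B (suc m) (suc j) x c eq = begin
    f ℕ.* p ℕ.* (c ℕ.+ suc (toℕ j)) !    ≡⟨ cong (λ z → f ℕ.* p ℕ.* z !) (ℕ.+-suc c (toℕ j)) ⟩
    f ℕ.* p ℕ.* (suc c ℕ.+ toℕ j) !      ≡⟨ ℕ.*-assoc f p ((suc c ℕ.+ toℕ j) !) ⟩
    f ℕ.* (p ℕ.* (suc c ℕ.+ toℕ j) !)
      ≡⟨ cong (f ℕ.*_) (splitProduct-! (A ∘ suc) (B ∘ suc) m j x (suc c) (λ i → trans (eq (suc i)) (cong suc (ℕ.+-suc c i)))) ⟩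
    f ℕ.* (R ℕ.* (suc c ℕ.+ m) !)        ≡⟨ ℕ.*-assoc f R ((suc c ℕ.+ m) !) ⟨
    f ℕ.* R ℕ.* (suc c ℕ.+ m) !          ≡⟨ cong (λ z → f ℕ.* R ℕ.* z !) (ℕ.+-suc c m) ⟨
    f ℕ.* R ℕ.* (c ℕ.+ suc m) !          ∎
    where
    f = k ℕ.* x ℕ.+ B 0
    p = splitProduct (A ∘ suc) (B ∘ suc) m j x
    R = Π (λ i → k ℕ.* x ℕ.+ B (suc i)) (toℕ j)

-- Spelled like the double product in `theorem6`, so that the two agree by unfolding.
vandermonde : ∀ {n} → (Fin n → ℕ) → ℚ
vandermonde {n} x = product (λ (j : Fin n) → product (λ (i : Fin (toℕ j)) → (+ x j ℤ.- + x (inject {i = j} i)) / 1))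

vandermonde-suc : ∀ {n} (x : Fin (suc n) → ℕ) →
  vandermonde x ≡ product (λ i → ι (x (suc i)) - ι (x zero)) * vandermonde (x ∘ suc)
vandermonde-suc x = begin
  1ℚ * product (λ j → (+ x (suc j) ℤ.- + x zero) / 1 * V j)
    ≡⟨ *-identityˡ (product (λ j → (+ x (suc j) ℤ.- + x zero) / 1 * V j)) ⟩
  product (λ j → (+ x (suc j) ℤ.- + x zero) / 1 * V j)
    ≡⟨ ∏.∑-distrib-+ (λ j → (+ x (suc j) ℤ.- + x zero) / 1) V ⟩
  product (λ j → (+ x (suc j) ℤ.- + x zero) / 1) * product V
    ≡⟨ cong (_* product V) (∏.sum-cong-≗ λ j → /1-- (x (suc j)) (x zero)) ⟩
  product (λ i → ι (x (suc i)) - ι (x zero)) * product V ∎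
  where
  V : _ → ℚ
  V j = product λ (i : Fin (toℕ j)) → (+ x (suc j) ℤ.- + x (suc (inject {i = j} i))) / 1

-- Take y = x_0 as the second argument of `splitProduct-step`. Each combined column then has entries
-- (x_i - y) h_{0,j} p′_j(x_i), which vanish in row 0. The row factors split off the Vandermonde
-- product, the column factors are row 0 of the triangle, and the smaller determinant uses A and h
-- shifted by one.
det-splitProduct : ∀ K k A B h → (∀ i → NonZero (A i)) → (∀ r j → h r j ℕ.+ K ℕ.* B j ≡ k ℕ.* A (r ℕ.+ j)) →
  ∀ m (x : Fin (suc m) → ℕ) →
  det (λ i j → ι (splitProduct K k A B m j (x i))) ≡ vandermonde x * ι (triangle h m)
det-splitProduct K k A B h A≢0 h≡ zero    x = refl
det-splitProduct K k A B h A≢0 h≡ (suc m) x =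
  *-cancelˡ-product-ι {suc m} (λ j → K ℕ.* y ℕ.+ A (toℕ j)) d≢0 (begin
    product d * det M
      ≡⟨ det-combineColumns d e M ⟨
    det (combineColumns d e M)
      ≡⟨ det-firstRow (combineColumns d e M) (λ j → trans (column zero j)
           (vanish (ι y) (g j) (ι (splitProduct K k (A ∘ suc) B m j y)))) ⟩
    ι (splitProduct K k A B (suc m) zero y) * det (λ i j → combineColumns d e M (suc i) (suc j))
      -- The corner entry p_0(y) is the product of the multipliers `d`, which is cancelled in the
      -- end.
      ≡⟨ cong₂ _*_ (sym (product-ι (λ i → K ℕ.* y ℕ.+ A i) (suc m))) (begin
           det (λ i j → combineColumns d e M (suc i) (suc j))
             ≡⟨ det-cong (λ i j → column (suc i) j) ⟩
           det (λ i j → w i * (g j * M′ i j))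
             ≡⟨ det-scaleRows w (λ i j → g j * M′ i j) ⟩
           product w * det (λ i j → g j * M′ i j)
             ≡⟨ cong (product w *_) (det-scaleColumns g M′) ⟩
           product w * (product g * det M′)
             ≡⟨ cong₂ (λ u v → product w * (u * v)) (product-ι (h 0) (suc m))
                  (det-splitProduct K k (A ∘ suc) B (h ∘ suc) (A≢0 ∘ suc) (h≡ ∘ suc) m (x ∘ suc)) ⟩
           product w * (ι (Π (h 0) (suc m)) * (vandermonde (x ∘ suc) * ι (triangle (h ∘ suc) m)))
             ≡⟨ solve 4 (λ w g v t → w :* (g :* (v :* t)) := w :* v :* (g :* t)) refl
                  (product w) (ι (Π (h 0) (suc m))) (vandermonde (x ∘ suc)) (ι (triangle (h ∘ suc) m)) ⟩
           product w * vandermonde (x ∘ suc) * (ι (Π (h 0) (suc m)) * ι (triangle (h ∘ suc) m))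
             ≡⟨ cong₂ _*_ (vandermonde-suc x) (ι-* (Π (h 0) (suc m)) (triangle (h ∘ suc) m)) ⟨
           vandermonde x * ι (triangle h (suc m)) ∎) ⟩
    product d * (vandermonde x * ι (triangle h (suc m))) ∎)
  where
  y = x zero
  M : Matrix (suc (suc m)) (suc (suc m))
  M i j = ι (splitProduct K k A B (suc m) j (x i))
  M′ : Matrix (suc m) (suc m)
  M′ i j = ι (splitProduct K k (A ∘ suc) B m j (x (suc i)))
  d≢0 : ∀ (j : Fin (suc m)) → NonZero (K ℕ.* y ℕ.+ A (toℕ j))
  d≢0 j = ℕ.>-nonZero (ℕ.m≤n⇒m≤o+n (K ℕ.* y) (ℕ.>-nonZero⁻¹ (A (toℕ j)) {{A≢0 (toℕ j)}}))
  d e g w : Fin (suc m) → ℚ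
  d j = ι (K ℕ.* y ℕ.+ A (toℕ j))
  e j = ι (k ℕ.* y ℕ.+ B (toℕ j))
  g j = ι (h 0 (toℕ j))
  w i = ι (x (suc i)) - ι y

  vanish : ∀ y g c → (y - y) * (g * c) ≡ 0ℚ
  vanish = solve 3 (λ y g c → (y :- y) :* (g :* c) := con 0ℚ) refl

  column : ∀ i j → combineColumns d e M i (suc j)
    ≡ (ι (x i) - ι y) * (g j * ι (splitProduct K k (A ∘ suc) B m j (x i)))
  column i j = begin
    d j * ι P - e j * ι Q
      -- The same term is added to and subtracted from the difference, because `splitProduct-step`
      -- is stated over ℕ without subtraction.
      ≡⟨ solve 5 (λ D p E q Y → D :* p :- E :* q := (D :* p :+ Y) :- (E :* q :+ Y)) refl
           (d j) (ι P) (e j) (ι Q) (ι y * (g j * ι R)) ⟩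
    (d j * ι P + ι y * (g j * ι R)) - (e j * ι Q + ι y * (g j * ι R))
      ≡⟨ cong (_- (e j * ι Q + ι y * (g j * ι R))) (begin
           d j * ι P + ι y * (g j * ι R)                ≡⟨ expand (K ℕ.* y ℕ.+ A (toℕ j)) P y (h 0 (toℕ j)) R ⟨
           ι ((K ℕ.* y ℕ.+ A (toℕ j)) ℕ.* P ℕ.+ y ℕ.* (h 0 (toℕ j) ℕ.* R))
             ≡⟨ cong ι (splitProduct-step K k A B m j (h 0 (toℕ j)) (h≡ 0 (toℕ j)) (x i) y) ⟩
           ι ((k ℕ.* y ℕ.+ B (toℕ j)) ℕ.* Q ℕ.+ x i ℕ.* (h 0 (toℕ j) ℕ.* R))
             ≡⟨ expand (k ℕ.* y ℕ.+ B (toℕ j)) Q (x i) (h 0 (toℕ j)) R ⟩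
           e j * ι Q + ι (x i) * (g j * ι R)            ∎) ⟩
    (e j * ι Q + ι (x i) * (g j * ι R)) - (e j * ι Q + ι y * (g j * ι R))
      ≡⟨ solve 4 (λ E X Y G → (E :+ X :* G) :- (E :+ Y :* G) := (X :- Y) :* G) refl (e j * ι Q) (ι (x i)) (ι y) (g j * ι R) ⟩
    (ι (x i) - ι y) * (g j * ι R) ∎
    where
    P = splitProduct K k A B (suc m) (suc j) (x i)
    Q = splitProduct K k A B (suc m) (inject₁ j) (x i)
    R = splitProduct K k (A ∘ suc) B m j (x i)
    expand : ∀ a b c d e → ι (a ℕ.* b ℕ.+ c ℕ.* (d ℕ.* e)) ≡ ι a * ι b + ι c * (ι d * ι e)
    expand a b c d e = begin
      ι (a ℕ.* b ℕ.+ c ℕ.* (d ℕ.* e))     ≡⟨ ι-+ (a ℕ.* b) (c ℕ.* (d ℕ.* e)) ⟩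
      ι (a ℕ.* b) + ι (c ℕ.* (d ℕ.* e))   ≡⟨ cong₂ _+_ (ι-* a b) (ι-* c (d ℕ.* e)) ⟩
      ι a * ι b + ι c * ι (d ℕ.* e)       ≡⟨ cong (λ z → ι a * ι b + ι c * z) (ι-* d e) ⟩
      ι a * ι b + ι c * (ι d * ι e)       ∎

-- Generalised Catalan numbers

C-factorials : ∀ a b → ((a ℕ.+ b) C a) ℕ.* (a ! ℕ.* b !) ≡ (a ℕ.+ b) !
C-factorials a b = begin
  ((a ℕ.+ b) C a) ℕ.* (a ! ℕ.* b !)
    ≡⟨ cong (λ c → ((a ℕ.+ b) C a) ℕ.* (a ! ℕ.* c !)) (ℕ.m+n∸m≡n a b) ⟨
  ((a ℕ.+ b) C a) ℕ.* (a ! ℕ.* (a ℕ.+ b ∸ a) !)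
    ≡⟨ cong (ℕ._* (a ! ℕ.* (a ℕ.+ b ∸ a) !)) (nCk≡n!/k![n-k]! (ℕ.m≤m+n a b)) ⟩
  ((a ℕ.+ b) ! ℕ./ (a ! ℕ.* (a ℕ.+ b ∸ a) !)) ℕ.* (a ! ℕ.* (a ℕ.+ b ∸ a) !)
    ≡⟨ m/n*n≡m (k![n∸k]!∣n! (ℕ.m≤m+n a b)) ⟩
  (a ℕ.+ b) ! ∎
  where instance _ = a !* (a ℕ.+ b ∸ a) !≢0

-- The factorials turn the binomial coefficient into (m + q + 1)!, whose top factor cancels the
-- denominator. In the application c = K q, so s is the remainder of m modulo K.
ballotNumber-*-factorials : ∀ m q c s → m ≡ s ℕ.+ c →
  ((+ m ℤ.- + c ℤ.+ + 1) / suc (m ℕ.+ q)) * (+ (suc (m ℕ.+ q) C suc m) / 1) * ι (suc m ! ℕ.* q !)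
    ≡ ι (suc s ℕ.* (m ℕ.+ q) !)
ballotNumber-*-factorials m q c s m≡ = begin
  Z / d * ι b * ι f                  ≡⟨ *-assoc (Z / d) (ι b) (ι f) ⟩
  Z / d * (ι b * ι f)                ≡⟨ cong (Z / d *_) (ι-* b f) ⟨
  Z / d * ι (b ℕ.* f)                ≡⟨ cong (λ z → Z / d * ι z) (C-factorials (suc m) q) ⟩
  Z / d * ι (d ℕ.* (m ℕ.+ q) !)      ≡⟨ cong (Z / d *_) (ι-* d ((m ℕ.+ q) !)) ⟩
  Z / d * (ι d * ι ((m ℕ.+ q) !))    ≡⟨ *-assoc (Z / d) (ι d) (ι ((m ℕ.+ q) !)) ⟨
  Z / d * ι d * ι ((m ℕ.+ q) !)      ≡⟨ cong (_* ι ((m ℕ.+ q) !)) (trans (/-*-cancel Z d) numerator) ⟩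
  ι (suc s) * ι ((m ℕ.+ q) !)        ≡⟨ ι-* (suc s) ((m ℕ.+ q) !) ⟨
  ι (suc s ℕ.* (m ℕ.+ q) !)          ∎
  where
  Z = + m ℤ.- + c ℤ.+ + 1
  d = suc (m ℕ.+ q)
  b = suc (m ℕ.+ q) C suc m
  f = suc m ! ℕ.* q !
  numerator : Z / 1 ≡ ι (suc s)
  numerator = begin
    Z / 1                        ≡⟨ /1-+ (+ m ℤ.- + c) (+ 1) ⟩
    (+ m ℤ.- + c) / 1 + ι 1      ≡⟨ cong (_+ ι 1) (/1-- m c) ⟩
    ι m - ι c + ι 1              ≡⟨ cong (λ z → z - ι c + ι 1) (trans (cong ι m≡) (ι-+ s c)) ⟩
    ι s + ι c - ι c + ι 1        ≡⟨ solve 3 (λ s c o → s :+ c :- c :+ o := o :+ s) refl (ι s) (ι c) (ι 1) ⟩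
    ι 1 + ι s                    ≡⟨ ι-+ 1 s ⟨
    ι (suc s)                    ∎

risingBase : ℕ → ℕ → ℕ
risingBase β i = 2+ (β ℕ.+ i)

-- The part of C_{Ka+j+β,k} depending only on j: the numerator s + 1 of the ballot fraction, and the
-- power of k = `2+ K′` from `factorial-skipping`.
columnFactor : ℕ → ℕ → ℕ → ℕ
columnFactor K′ β j = suc ((β ℕ.+ j) % suc K′) ℕ.* (2+ K′) ℕ.^ ((β ℕ.+ j) ℕ./ suc K′)

module _ (K′ : ℕ) {β : ℕ} (β≤K : β ≤ suc K′) where

  private
    K k : ℕ
    K = suc K′
    k = suc K

  -- With M = K a + j + β and Q = a + e its quotient by K, C_{M,k} is (s + 1) (M + Q)! / ((M + 1)!
  -- Q!). The quotient (M + Q)! / Q! yields the forms of slope `k` by `factorial-skipping`, and (K a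
  -- + β + m + 1)! / (M + 1)! those of slope `K` by `splitProduct-!`.
  genCatalan-splitProduct : ∀ m (j : Fin (suc m)) a →
    ι (a ! ℕ.* (K ℕ.* a ℕ.+ β ℕ.+ suc m) !) * genCatalan (K ℕ.* a ℕ.+ toℕ j ℕ.+ β) k
      ≡ ι ((k ℕ.* a ℕ.+ β) !) * (ι (columnFactor K′ β (toℕ j)) * ι (splitProduct K k (risingBase β) (skipping K′ β) m j a))
  genCatalan-splitProduct m j a = *-cancelˡ-ι (suc M ! ℕ.* Q !) {{suc M !* Q !≢0}} (begin
    ι (suc M ! ℕ.* Q !) * (ι D * genCatalan M k)
      ≡⟨ solve 3 (λ x y z → x :* (y :* z) := y :* (z :* x)) refl (ι (suc M ! ℕ.* Q !)) (ι D) (genCatalan M k) ⟩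
    ι D * (genCatalan M k * ι (suc M ! ℕ.* Q !))
      ≡⟨ cong (ι D *_) (ballotNumber-*-factorials M Q (K ℕ.* Q) s M≡) ⟩
    ι D * ι (suc s ℕ.* (M ℕ.+ Q) !)
      ≡⟨ ι-* D (suc s ℕ.* (M ℕ.+ Q) !) ⟨
    ι (D ℕ.* (suc s ℕ.* (M ℕ.+ Q) !))
      ≡⟨ cong ι crossed ⟩
    ι (suc M ! ℕ.* Q ! ℕ.* (G ℕ.* (columnFactor K′ β J ℕ.* p)))
      ≡⟨ trans (ι-* (suc M ! ℕ.* Q !) _) (cong (ι (suc M ! ℕ.* Q !) *_)
           (trans (ι-* G _) (cong (ι G *_) (ι-* (columnFactor K′ β J) p)))) ⟩
    ι (suc M ! ℕ.* Q !) * (ι G * (ι (columnFactor K′ β J) * ι p)) ∎)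
    where
    J = toℕ j
    M = K ℕ.* a ℕ.+ J ℕ.+ β
    Q = M ℕ./ K
    e = (β ℕ.+ J) ℕ./ K
    s = (β ℕ.+ J) % K
    D = a ! ℕ.* (K ℕ.* a ℕ.+ β ℕ.+ suc m) !
    G = (k ℕ.* a ℕ.+ β) !
    p = splitProduct K k (risingBase β) (skipping K′ β) m j a
    c = K ℕ.* a ℕ.+ suc β
    R = Π (λ i → k ℕ.* a ℕ.+ skipping K′ β i) J

    M≡s+ : M ≡ s ℕ.+ (a ℕ.+ e) ℕ.* K
    M≡s+ = begin
      K ℕ.* a ℕ.+ J ℕ.+ β                  ≡⟨ arith₁ (K ℕ.* a) J β ⟩
      K ℕ.* a ℕ.+ (β ℕ.+ J)                ≡⟨ cong (K ℕ.* a ℕ.+_) (m≡m%n+[m/n]*n (β ℕ.+ J) K) ⟩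
      K ℕ.* a ℕ.+ (s ℕ.+ e ℕ.* K)          ≡⟨ arith₂ K a s e ⟩
      s ℕ.+ (a ℕ.+ e) ℕ.* K                ∎
      where
      arith₁ : ∀ x J β → x ℕ.+ J ℕ.+ β ≡ x ℕ.+ (β ℕ.+ J)
      arith₁ = solve-∀
      arith₂ : ∀ K a s e → K ℕ.* a ℕ.+ (s ℕ.+ e ℕ.* K) ≡ s ℕ.+ (a ℕ.+ e) ℕ.* K
      arith₂ = solve-∀

    Q≡ : Q ≡ a ℕ.+ e
    Q≡ = trans (cong (ℕ._/ K) M≡s+) ([r+q*n]/n≡q (a ℕ.+ e) (m%n<n (β ℕ.+ J) K))

    M≡ : M ≡ s ℕ.+ K ℕ.* Q
    M≡ = trans M≡s+ (cong (s ℕ.+_) (trans (ℕ.*-comm (a ℕ.+ e) K) (cong (K ℕ.*_) (sym Q≡))))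

    M+Q≡ : M ℕ.+ Q ≡ k ℕ.* a ℕ.+ (β ℕ.+ J) ℕ.+ e
    M+Q≡ = trans (cong (M ℕ.+_) Q≡) (arith K a J β e)
      where
      arith : ∀ K a J β e → K ℕ.* a ℕ.+ J ℕ.+ β ℕ.+ (a ℕ.+ e) ≡ suc K ℕ.* a ℕ.+ (β ℕ.+ J) ℕ.+ e
      arith = solve-∀

    crossed : D ℕ.* (suc s ℕ.* (M ℕ.+ Q) !) ≡ suc M ! ℕ.* Q ! ℕ.* (G ℕ.* (columnFactor K′ β J ℕ.* p))
    crossed = begin
      D ℕ.* (suc s ℕ.* (M ℕ.+ Q) !)
        ≡⟨ cong₂ (λ u v → a ! ℕ.* u ! ℕ.* (suc s ℕ.* v !)) (index₁ (K ℕ.* a) β m) M+Q≡ ⟩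
      a ! ℕ.* (c ℕ.+ m) ! ℕ.* (suc s ℕ.* (k ℕ.* a ℕ.+ (β ℕ.+ J) ℕ.+ e) !)
        ≡⟨ arith₁ (a !) ((c ℕ.+ m) !) (suc s) ((k ℕ.* a ℕ.+ (β ℕ.+ J) ℕ.+ e) !) ⟩
      suc s ℕ.* (c ℕ.+ m) ! ℕ.* ((k ℕ.* a ℕ.+ (β ℕ.+ J) ℕ.+ e) ! ℕ.* a !)
        ≡⟨ cong (suc s ℕ.* (c ℕ.+ m) ! ℕ.*_) (factorial-skipping K′ β≤K a J) ⟩
      suc s ℕ.* (c ℕ.+ m) ! ℕ.* (k ℕ.^ e ℕ.* G ℕ.* R ℕ.* (a ℕ.+ e) !)
        ≡⟨ arith₂ (suc s) ((c ℕ.+ m) !) (k ℕ.^ e) G R ((a ℕ.+ e) !) ⟩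
      R ℕ.* (c ℕ.+ m) ! ℕ.* (a ℕ.+ e) ! ℕ.* (G ℕ.* columnFactor K′ β J)
        ≡⟨ cong (λ z → z ℕ.* (a ℕ.+ e) ! ℕ.* (G ℕ.* columnFactor K′ β J))
             (splitProduct-! K k (risingBase β) (skipping K′ β) m j a c (index₂ (K ℕ.* a) β)) ⟨
      p ℕ.* (c ℕ.+ J) ! ℕ.* (a ℕ.+ e) ! ℕ.* (G ℕ.* columnFactor K′ β J)
        ≡⟨ cong₂ (λ u v → p ℕ.* u ! ℕ.* v ! ℕ.* (G ℕ.* columnFactor K′ β J)) (index₃ (K ℕ.* a) β J) (sym Q≡) ⟩
      p ℕ.* suc M ! ℕ.* Q ! ℕ.* (G ℕ.* columnFactor K′ β J)
        ≡⟨ arith₃ p (suc M !) (Q !) G (columnFactor K′ β J) ⟩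
      suc M ! ℕ.* Q ! ℕ.* (G ℕ.* (columnFactor K′ β J ℕ.* p)) ∎
      where
      index₁ : ∀ x β m → x ℕ.+ β ℕ.+ suc m ≡ x ℕ.+ suc β ℕ.+ m
      index₁ = solve-∀
      index₂ : ∀ x β i → x ℕ.+ suc (suc (β ℕ.+ i)) ≡ suc (x ℕ.+ suc β ℕ.+ i)
      index₂ = solve-∀
      index₃ : ∀ x β J → x ℕ.+ suc β ℕ.+ J ≡ suc (x ℕ.+ J ℕ.+ β)
      index₃ = solve-∀
      arith₁ : ∀ a c s f → a ℕ.* c ℕ.* (s ℕ.* f) ≡ s ℕ.* c ℕ.* (f ℕ.* a)
      arith₁ = solve-∀
      arith₂ : ∀ s c x G R f → s ℕ.* c ℕ.* (x ℕ.* G ℕ.* R ℕ.* f) ≡ R ℕ.* c ℕ.* f ℕ.* (G ℕ.* (s ℕ.* x))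
      arith₂ = solve-∀
      arith₃ : ∀ p m q g c → p ℕ.* m ℕ.* q ℕ.* (g ℕ.* c) ≡ m ℕ.* q ℕ.* (g ℕ.* (c ℕ.* p))
      arith₃ = solve-∀

  -- Writing N = β + j, the difference k A_{r+j} - K B_j is (r + 1) k + 1 + N - K e, and N - K e is
  -- the remainder s.
  residueFactor-skipping : ∀ r j →
    residueFactor K′ β (suc r) j ℕ.+ K ℕ.* skipping K′ β j ≡ k ℕ.* risingBase β (r ℕ.+ j)
  residueFactor-skipping r j = begin
    suc r ℕ.* k ℕ.+ suc s ℕ.+ K ℕ.* suc (N ℕ.+ e)         ≡⟨ arith₁ r K s N e ⟩
    (suc r ℕ.* k ℕ.+ suc K ℕ.+ K ℕ.* N) ℕ.+ (s ℕ.+ e ℕ.* K)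
      ≡⟨ cong ((suc r ℕ.* k ℕ.+ suc K ℕ.+ K ℕ.* N) ℕ.+_) (m≡m%n+[m/n]*n N K) ⟨
    (suc r ℕ.* k ℕ.+ suc K ℕ.+ K ℕ.* N) ℕ.+ N             ≡⟨ arith₂ r K β j ⟩
    k ℕ.* risingBase β (r ℕ.+ j)                            ∎
    where
    N = β ℕ.+ j
    s = N % K
    e = N ℕ./ K
    arith₁ : ∀ r K s N e → suc r ℕ.* suc K ℕ.+ suc s ℕ.+ K ℕ.* suc (N ℕ.+ e)
      ≡ (suc r ℕ.* suc K ℕ.+ suc K ℕ.+ K ℕ.* N) ℕ.+ (s ℕ.+ e ℕ.* K)
    arith₁ = solve-∀
    arith₂ : ∀ r K β j → (suc r ℕ.* suc K ℕ.+ suc K ℕ.+ K ℕ.* (β ℕ.+ j)) ℕ.+ (β ℕ.+ j)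
      ≡ suc K ℕ.* suc (suc (β ℕ.+ (r ℕ.+ j)))
    arith₂ = solve-∀

  -- The residue parts of the column factors are row 0 of the triangle of `residueFactor`, and the
  -- determinant supplies the rows from 1 on; together they complete the triangle evaluated in
  -- `triangle-residueFactor`.
  columnFactor-triangle : ∀ m →
    Π (columnFactor K′ β) (suc m) ℕ.* triangle (residueFactor K′ β ∘ suc) m ℕ.* Π (λ i → (k ℕ.* i ℕ.+ β) !) (suc m)
      ≡ Π (λ i → (K ℕ.* i ℕ.+ β ℕ.+ suc m) !) (suc m)
  columnFactor-triangle m = trans (cong (ℕ._* F) (begin
    Π (columnFactor K′ β) (suc m) ℕ.* T
      ≡⟨ cong (ℕ._* T) (Π-* (λ j → suc ((β ℕ.+ j) % K)) (λ j → k ℕ.^ ((β ℕ.+ j) ℕ./ K)) (suc m)) ⟩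
    Π (residueFactor K′ β 0) (suc m) ℕ.* Π (λ j → k ℕ.^ ((β ℕ.+ j) ℕ./ K)) (suc m) ℕ.* T
      ≡⟨ arith (Π (residueFactor K′ β 0) (suc m)) _ T ⟩
    Π (λ j → k ℕ.^ ((β ℕ.+ j) ℕ./ K)) (suc m) ℕ.* triangle (residueFactor K′ β) (suc m) ∎))
    (triangle-residueFactor K′ β≤K (suc m))
    where
    T = triangle (residueFactor K′ β ∘ suc) m
    F = Π (λ i → (k ℕ.* i ℕ.+ β) !) (suc m)
    arith : ∀ a b c → a ℕ.* b ℕ.* c ≡ b ℕ.* (a ℕ.* c)
    arith = solve-∀

-- Clearing denominators and assembling the formula

factorialQuotient-* : ∀ n k β i a →
  ι ((k ℕ.* i ℕ.+ β) !) * ι (a ! ℕ.* ((k ∸ 1) ℕ.* a ℕ.+ β ℕ.+ n) !) * factorialQuotient n k β i a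
    ≡ ι (((k ∸ 1) ℕ.* i ℕ.+ β ℕ.+ n) !) * ι ((k ℕ.* a ℕ.+ β) !)
factorialQuotient-* n k β i a = begin
  ι x * ι (y ℕ.* z) * q     ≡⟨ *-comm (ι x * ι (y ℕ.* z)) q ⟩
  q * (ι x * ι (y ℕ.* z))   ≡⟨ cong (q *_) (ι-* x (y ℕ.* z)) ⟨
  q * ι (x ℕ.* (y ℕ.* z))   ≡⟨ cong (λ w → q * ι w) (ℕ.*-assoc x y z) ⟨
  q * ι (x ℕ.* y ℕ.* z)
    ≡⟨ /-*-cancel (+ (u ℕ.* v)) (x ℕ.* y ℕ.* z) {{ !*!*!≢0 (k ℕ.* i ℕ.+ β) a ((k ∸ 1) ℕ.* a ℕ.+ β ℕ.+ n)}} ⟩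
  ι (u ℕ.* v)               ≡⟨ ι-* u v ⟩
  ι u * ι v                 ∎
  where
  x = (k ℕ.* i ℕ.+ β) !
  y = a !
  z = ((k ∸ 1) ℕ.* a ℕ.+ β ℕ.+ n) !
  u = ((k ∸ 1) ℕ.* i ℕ.+ β ℕ.+ n) !
  v = (k ℕ.* a ℕ.+ β) !
  q = factorialQuotient n k β i a

theorem6 : (n k β : ℕ) .{{_ : NonZero n}} .{{_ : NonTrivial k}} (α : Fin n → ℕ) → β ≤ k ∸ 1 →
    det (λ (i j : Fin n) → genCatalan ((k ∸ 1) ℕ.* α i ℕ.+ toℕ j ℕ.+ β) k)
    ≡ product (λ (j : Fin n) → product (λ (i : Fin (toℕ j)) → (+ α j ℤ.- + α (inject {i = j} i)) / 1))
    * product (λ (i : Fin n) → factorialQuotient n k β (toℕ i) (α i))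
theorem6 n@(suc m) k@(2+ K′) β α β≤K =
  -- Both sides are multiplied by the denominators of the factorial quotients, split in two: `D i`
  -- also clears row `i` of the matrix, and `E` supplies the factorials that `columnFactor-triangle`
  -- requires.
  *-cancelˡ-product-ι E (λ i → (k ℕ.* toℕ i ℕ.+ β) !≢0)
  (*-cancelˡ-product-ι D (λ i → α i !* (K ℕ.* α i ℕ.+ β ℕ.+ n) !≢0) (begin
  pD * (pE * det M)
    ≡⟨ solve 3 (λ d e x → d :* (e :* x) := e :* (d :* x)) refl pD pE (det M) ⟩
  pE * (pD * det M)
    ≡⟨ cong (pE *_) (begin
         pD * det M
           ≡⟨ det-scaleRows (ι ∘ D) M ⟨
         det (λ i j → ι (D i) * M i j)
           ≡⟨ det-cong {A = λ i j → ι (D i) * M i j} {B = λ i j → ι (G i) * (g j * S i j)}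
                (λ i j → genCatalan-splitProduct K′ β≤K m j (α i)) ⟩
         det (λ i j → ι (G i) * (g j * S i j))
           ≡⟨ det-scaleRows (ι ∘ G) (λ i j → g j * S i j) ⟩
         pG * det (λ i j → g j * S i j)
           ≡⟨ cong (pG *_) (det-scaleColumns g S) ⟩
         pG * (product g * det S)
           ≡⟨ cong₂ (λ u v → pG * (u * v)) (product-ι (columnFactor K′ β) n)
                (det-splitProduct K k (risingBase β) (skipping K′ β) (residueFactor K′ β ∘ suc)
                  (λ _ → _) (residueFactor-skipping K′ β≤K) m α) ⟩
         pG * (ι g′ * (V * ι T)) ∎) ⟩
  pE * (pG * (ι g′ * (V * ι T)))
    ≡⟨ solve 5 (λ e G g v t → e :* (G :* (g :* (v :* t))) := v :* (g :* t :* e :* G)) refl pE pG (ι g′) V (ι T) ⟩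
  V * (ι g′ * ι T * pE * pG)
    ≡⟨ cong (λ z → V * (z * pG)) (begin
         ι g′ * ι T * pE             ≡⟨ cong₂ _*_ (ι-* g′ T) (sym (product-ι (λ i → (k ℕ.* i ℕ.+ β) !) n)) ⟨
         ι (g′ ℕ.* T) * ι E′         ≡⟨ ι-* (g′ ℕ.* T) E′ ⟨
         ι (g′ ℕ.* T ℕ.* E′)         ≡⟨ cong ι (columnFactor-triangle K′ β≤K m) ⟩
         ι (Π (λ i → (K ℕ.* i ℕ.+ β ℕ.+ n) !) n) ≡⟨ product-ι (λ i → (K ℕ.* i ℕ.+ β ℕ.+ n) !) n ⟨
         product (ι ∘ U)             ∎) ⟩
  V * (product (ι ∘ U) * pG)
    ≡⟨ cong (V *_) (begin
         product (ι ∘ U) * pG        ≡⟨ ∏.∑-distrib-+ (ι ∘ U) (ι ∘ G) ⟨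
         product (λ i → ι (U i) * ι (G i))
           ≡⟨ ∏.sum-cong-≗ (λ i → factorialQuotient-* n k β (toℕ i) (α i)) ⟨
         product (λ i → ι (E i) * ι (D i) * q i)
           ≡⟨ ∏.∑-distrib-+ (λ i → ι (E i) * ι (D i)) q ⟩
         product (λ i → ι (E i) * ι (D i)) * product q
           ≡⟨ cong (_* product q) (∏.∑-distrib-+ (ι ∘ E) (ι ∘ D)) ⟩
         pE * pD * product q         ∎) ⟩
  V * (pE * pD * product q)
    ≡⟨ solve 4 (λ v e d q → v :* (e :* d :* q) := d :* (e :* (v :* q))) refl V pE pD (product q) ⟩
  pD * (pE * (V * product q)) ∎))
  where
  K : ℕ
  K = suc K′
  M S : Matrix n n
  M i j = genCatalan (K ℕ.* α i ℕ.+ toℕ j ℕ.+ β) k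
  S i j = ι (splitProduct K k (risingBase β) (skipping K′ β) m j (α i))
  D E G U : Fin n → ℕ
  D i = α i ! ℕ.* (K ℕ.* α i ℕ.+ β ℕ.+ n) !
  E i = (k ℕ.* toℕ i ℕ.+ β) !
  G i = (k ℕ.* α i ℕ.+ β) !
  U i = (K ℕ.* toℕ i ℕ.+ β ℕ.+ n) !
  g q : Fin n → ℚ
  g j = ι (columnFactor K′ β (toℕ j))
  q i = factorialQuotient n k β (toℕ i) (α i)
  g′ = Π (columnFactor K′ β) n
  E′ = Π (λ i → (k ℕ.* i ℕ.+ β) !) n
  T = triangle (residueFactor K′ β ∘ suc) m
  V = vandermonde α
  pD = product (ι ∘ D)
  pE = product (ι ∘ E)
  pG = product (ι ∘ G)
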